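{- For Lebesgue-almost all $x\in(0,1]$, $$\lim_{n\to\infty}\frac{L_n(x)}{\log_2 n}=1,$$ where $L_n(x)=\max\{d_i(x):1\le i\le n\}$.
   Context: $\mathbb{N}=\{1,2,3,\dots\}$. Every $x\in(0,1]$ has a unique expansion $x=\sum_{i=1}^{\infty}2^{ -(d_1(x)+d_2(x)+\cdots+d_i(x))}$ with all $d_i(x)\in\mathbb{N}$ (the power-2-decaying Gauss-like expansion); this defines the digit functions $d_i:(0,1]\to\mathbb{N}$. Equivalently, with $T:(0,1]\to(0,1]$ given by $Tx=2^nx-1$ for $x\in(2^{ -n},2^{ -(n-1)}]$, $n\in\mathbb{N}$, the digit $d_i(x)$ is the unique $n\in\mathbb{N}$ with $T^{i-1}x\in(2^{ -n},2^{ -(n-1)}]$. -}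

module Defs where

open import Data.Nat.Base as ℕ using (ℕ; zero; suc; NonZero)
import Data.Nat.Properties as ℕ
open import Data.Nat.Logarithm
open import Data.Integer.Base as ℤ using (+_; +[1+_]; +0; -[1+_]; +≤+; +<+)
import Data.Integer.Properties as ℤ
open import Data.Rational.Base as ℚ using (ℚ; mkℚ; 0ℚ; 1ℚ; ½; *<*)
import Data.Rational.Properties as ℚ
open import Data.Rational.Solver using (module +-*-Solver)
import Data.Rational.Unnormalised.Base as ℚᵘ
import Data.Rational.Unnormalised.Properties as ℚᵘ
open import Data.Product using (∃-syntax; Σ-syntax; _×_; _,_)
open import Data.Sum using (inj₁; inj₂)
open import Relation.Nullary using (¬_; yes; no; contradiction)
open import Relation.Binary.PropositionalEquality
open import Induction.WellFounded using (Acc; acc)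
open import Data.Nat.Induction using (<-wellFounded)

module Estimates where

  open +-*-Solver using (solve; _:=_; _:+_; _:*_; _:-_; :-_; con)

  half+half : ∀ p → ½ ℚ.* p ℚ.+ ½ ℚ.* p ≡ p
  half+half = solve 1 (λ p → con ½ :* p :+ con ½ :* p := p) refl

  *-pos : ∀ {p q} → 0ℚ ℚ.< p → 0ℚ ℚ.< q → 0ℚ ℚ.< p ℚ.* q
  *-pos {p} {q} 0<p 0<q = ℚ.positive⁻¹ (p ℚ.* q)
    {{ℚ.pos*pos⇒pos p {{ℚ.positive 0<p}} q {{ℚ.positive 0<q}}}}

  half-pos : ∀ {p} → 0ℚ ℚ.< p → 0ℚ ℚ.< ½ ℚ.* p
  half-pos = *-pos (ℚ.positive⁻¹ ½)

  abs-< : ∀ {p q} → p ℚ.< q → ℚ.- p ℚ.< q → ℚ.∣ p ∣ ℚ.< q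
  abs-< {p} p<q -p<q with ℚ.∣p∣≡p∨∣p∣≡-p p
  ... | inj₁ eq = subst (ℚ._< _) (sym eq) p<q
  ... | inj₂ eq = subst (ℚ._< _) (sym eq) -p<q

  ∣p-q∣≡∣q-p∣ : ∀ p q → ℚ.∣ p ℚ.- q ∣ ≡ ℚ.∣ q ℚ.- p ∣
  ∣p-q∣≡∣q-p∣ p q = trans (sym (ℚ.∣-p∣≡∣p∣ (p ℚ.- q)))
    (cong ℚ.∣_∣ (solve 2 (λ p q → :- (p :- q) := q :- p) refl p q))

  swap : ∀ p q → p ℚ.- q ≡ ℚ.- (q ℚ.- p)
  swap = solve 2 (λ p q → p :- q := :- (q :- p)) refl

  p-q<r : ∀ {p q r} → p ℚ.< q ℚ.+ r → p ℚ.- q ℚ.< r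
  p-q<r {p} {q} {r} lt = subst (p ℚ.- q ℚ.<_)
    (solve 2 (λ q r → q :+ r :- q := r) refl q r)
    (ℚ.+-monoˡ-< (ℚ.- q) lt)

  -- | |p| - |q| | ≤ |p - q|
  abs-abs : ∀ p q {r} → ℚ.∣ p ℚ.- q ∣ ℚ.< r → ℚ.∣ p ∣ ℚ.< ℚ.∣ q ∣ ℚ.+ r
  abs-abs p q {r} lt = begin-strict
    ℚ.∣ p ∣                      ≡⟨ cong ℚ.∣_∣ (solve 2 (λ p q → p := q :+ (p :- q)) refl p q) ⟩
    ℚ.∣ q ℚ.+ (p ℚ.- q) ∣        ≤⟨ ℚ.∣p+q∣≤∣p∣+∣q∣ q (p ℚ.- q) ⟩
    ℚ.∣ q ∣ ℚ.+ ℚ.∣ p ℚ.- q ∣    <⟨ ℚ.+-monoʳ-< ℚ.∣ q ∣ lt ⟩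
    ℚ.∣ q ∣ ℚ.+ r                ∎
    where open ℚ.≤-Reasoning

  archimedean : ∀ ε → 0ℚ ℚ.< ε → ∃[ N ] + 1 ℚ./ suc N ℚ.< ε
  archimedean (mkℚ +[1+ a ] d c) _ = suc d , ℚ.toℚᵘ-cancel-< (begin-strict
    ℚ.toℚᵘ (+ 1 ℚ./ suc (suc d))   ≃⟨ ℚ.toℚᵘ-fromℚᵘ (+ 1 ℚᵘ./ suc (suc d)) ⟩
    + 1 ℚᵘ./ suc (suc d)           <⟨ ℚᵘ.*<* (+<+ (subst₂ ℕ._<_
                                       (sym (ℕ.+-identityʳ (suc d))) refl
                                       (ℕ.m≤m+n (suc (suc d)) (a ℕ.* suc (suc d))))) ⟩
    ℚ.toℚᵘ (mkℚ +[1+ a ] d c)      ∎)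
    where open ℚᵘ.≤-Reasoning
  archimedean (mkℚ +0 d c)       (*<* (+<+ ()))
  archimedean (mkℚ -[1+ _ ] d c) (*<* ())

  frac-≤ : ∀ a b m n .{{_ : NonZero m}} .{{_ : NonZero n}} →
           a ℕ.* n ℕ.≤ b ℕ.* m → + a ℚ./ m ℚ.≤ + b ℚ./ n
  frac-≤ a b m@(suc _) n@(suc _) le = ℚ.toℚᵘ-cancel-≤ (begin
    ℚ.toℚᵘ (+ a ℚ./ m)   ≃⟨ ℚ.toℚᵘ-fromℚᵘ (+ a ℚᵘ./ m) ⟩
    + a ℚᵘ./ m           ≤⟨ ℚᵘ.*≤* (subst₂ ℤ._≤_ (ℤ.pos-* a n) (ℤ.pos-* b m) (+≤+ le)) ⟩
    + b ℚᵘ./ n           ≃⟨ ℚ.toℚᵘ-fromℚᵘ (+ b ℚᵘ./ n) ⟨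
    ℚ.toℚᵘ (+ b ℚ./ n)   ∎)
    where open ℚᵘ.≤-Reasoning

  frac-< : ∀ a b m n .{{_ : NonZero m}} .{{_ : NonZero n}} →
           a ℕ.* n ℕ.< b ℕ.* m → + a ℚ./ m ℚ.< + b ℚ./ n
  frac-< a b m@(suc _) n@(suc _) lt = ℚ.toℚᵘ-cancel-< (begin-strict
    ℚ.toℚᵘ (+ a ℚ./ m)   ≃⟨ ℚ.toℚᵘ-fromℚᵘ (+ a ℚᵘ./ m) ⟩
    + a ℚᵘ./ m           <⟨ ℚᵘ.*<* (subst₂ ℤ._<_ (ℤ.pos-* a n) (ℤ.pos-* b m) (+<+ lt)) ⟩
    + b ℚᵘ./ n           ≃⟨ ℚ.toℚᵘ-fromℚᵘ (+ b ℚᵘ./ n) ⟨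
    ℚ.toℚᵘ (+ b ℚ./ n)   ∎)
    where open ℚᵘ.≤-Reasoning

  frac-suc : ∀ b n .{{_ : NonZero n}} → + suc b ℚ./ n ≡ + b ℚ./ n ℚ.+ + 1 ℚ./ n
  frac-suc b n@(suc _) = ℚ.toℚᵘ-injective (begin
    ℚ.toℚᵘ (+ suc b ℚ./ n)                          ≈⟨ ℚ.toℚᵘ-fromℚᵘ (+ suc b ℚᵘ./ n) ⟩
    + suc b ℚᵘ./ n                                  ≈⟨ ℚᵘ.*≡* core ⟩
    + b ℚᵘ./ n ℚᵘ.+ + 1 ℚᵘ./ n                      ≈⟨ ℚᵘ.+-cong (ℚ.toℚᵘ-fromℚᵘ (+ b ℚᵘ./ n))
                                                                  (ℚ.toℚᵘ-fromℚᵘ (+ 1 ℚᵘ./ n)) ⟨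
    ℚ.toℚᵘ (+ b ℚ./ n) ℚᵘ.+ ℚ.toℚᵘ (+ 1 ℚ./ n)      ≈⟨ ℚ.toℚᵘ-homo-+ (+ b ℚ./ n) (+ 1 ℚ./ n) ⟨
    ℚ.toℚᵘ (+ b ℚ./ n ℚ.+ + 1 ℚ./ n)                ∎)
    where
    open import Relation.Binary.Reasoning.Setoid ℚᵘ.≃-setoid
    core : + suc b ℤ.* (+ n ℤ.* + n) ≡ (+ b ℤ.* + n ℤ.+ + 1 ℤ.* + n) ℤ.* + n
    core = trans (sym (ℤ.*-assoc (+ suc b) (+ n) (+ n))) (cong (ℤ._* + n)
      (trans (cong (ℤ._* + n) (cong +_ (ℕ.+-comm 1 b))) (ℤ.*-distribʳ-+ (+ n) (+ b) (+ 1))))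

  2*⌊n/2⌋≤n : ∀ n → 2 ℕ.* ℕ.⌊ n /2⌋ ℕ.≤ n
  2*⌊n/2⌋≤n n = begin
    2 ℕ.* ℕ.⌊ n /2⌋              ≡⟨ cong (ℕ.⌊ n /2⌋ ℕ.+_) (ℕ.+-identityʳ _) ⟩
    ℕ.⌊ n /2⌋ ℕ.+ ℕ.⌊ n /2⌋      ≤⟨ ℕ.+-monoʳ-≤ ℕ.⌊ n /2⌋ (ℕ.⌊n/2⌋≤⌈n/2⌉ n) ⟩
    ℕ.⌊ n /2⌋ ℕ.+ ℕ.⌈ n /2⌉      ≡⟨ ℕ.⌊n/2⌋+⌈n/2⌉≡n n ⟩
    n                            ∎
    where open ℕ.≤-Reasoning

  2^⌊log₂⌋≤′ : ∀ n → Acc ℕ._<_ n → .{{NonZero n}} → 2 ℕ.^ ⌊log₂ n ⌋ ℕ.≤ n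
  2^⌊log₂⌋≤′ 1 _ = ℕ.≤-refl
  2^⌊log₂⌋≤′ n@(suc (suc k)) (acc rs) = go ⌊log₂ n ⌋ (⌊log₂⌊n/2⌋⌋≡⌊log₂n⌋∸1 n)
    where
    ih = 2^⌊log₂⌋≤′ ℕ.⌊ n /2⌋ (rs (ℕ.⌊n/2⌋<n (suc k)))
    go : ∀ l → ⌊log₂ ℕ.⌊ n /2⌋ ⌋ ≡ l ℕ.∸ 1 → 2 ℕ.^ l ℕ.≤ n
    go zero    _  = ℕ.s≤s ℕ.z≤n
    go (suc l) eq = ℕ.≤-trans
      (ℕ.*-monoʳ-≤ 2 (subst (λ m → 2 ℕ.^ m ℕ.≤ ℕ.⌊ n /2⌋) eq ih)) (2*⌊n/2⌋≤n n)

  2^⌊log₂⌋≤ : ∀ n .{{_ : NonZero n}} → 2 ℕ.^ ⌊log₂ n ⌋ ℕ.≤ n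
  2^⌊log₂⌋≤ n = 2^⌊log₂⌋≤′ n (<-wellFounded n)

  <2^1+⌊log₂⌋ : ∀ n → n ℕ.< 2 ℕ.^ suc ⌊log₂ n ⌋
  <2^1+⌊log₂⌋ n = ℕ.≰⇒> λ le → ℕ.<-irrefl refl
    (subst (ℕ._≤ ⌊log₂ n ⌋) (⌊log₂[2^n]⌋≡n (suc ⌊log₂ n ⌋)) (⌊log₂⌋-mono-≤ le))

  ⌊log₂^⌋-cross : ∀ n .{{_ : NonZero n}} j k .{{_ : NonZero j}} .{{_ : NonZero k}} →
                  ⌊log₂ (n ℕ.^ j) ⌋ ℕ.* k ℕ.< suc ⌊log₂ (n ℕ.^ k) ⌋ ℕ.* j
  ⌊log₂^⌋-cross n j@(suc _) k@(suc _) = ℕ.≰⇒> λ le → ℕ.<-irrefl refl (begin-strict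
    2 ℕ.^ (suc b ℕ.* j)      ≤⟨ ℕ.^-monoʳ-≤ 2 le ⟩
    2 ℕ.^ (a ℕ.* k)          ≡⟨ ℕ.^-*-assoc 2 a k ⟨
    (2 ℕ.^ a) ℕ.^ k          ≤⟨ ℕ.^-monoˡ-≤ k (2^⌊log₂⌋≤ (n ℕ.^ j) {{ℕ.m^n≢0 n j}}) ⟩
    (n ℕ.^ j) ℕ.^ k          ≡⟨ ℕ.^-*-assoc n j k ⟩
    n ℕ.^ (j ℕ.* k)          ≡⟨ cong (n ℕ.^_) (ℕ.*-comm j k) ⟩
    n ℕ.^ (k ℕ.* j)          ≡⟨ ℕ.^-*-assoc n k j ⟨
    (n ℕ.^ k) ℕ.^ j          <⟨ ℕ.^-monoˡ-< j (<2^1+⌊log₂⌋ (n ℕ.^ k)) ⟩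
    (2 ℕ.^ suc b) ℕ.^ j      ≡⟨ ℕ.^-*-assoc 2 (suc b) j ⟩
    2 ℕ.^ (suc b ℕ.* j)      ∎)
    where
    open ℕ.≤-Reasoning
    a = ⌊log₂ (n ℕ.^ j) ⌋
    b = ⌊log₂ (n ℕ.^ k) ⌋

  frac-difference : ∀ a b N j k → a ℕ.* suc k ℕ.< suc b ℕ.* suc j → N ℕ.≤ k →
                    + a ℚ./ suc j ℚ.- + b ℚ./ suc k ℚ.< + 1 ℚ./ suc N
  frac-difference a b N j k cross N≤k = ℚ.<-≤-trans
    (p-q<r {+ a ℚ./ suc j} {+ b ℚ./ suc k} {+ 1 ℚ./ suc k}
      (subst (+ a ℚ./ suc j ℚ.<_) (frac-suc b (suc k)) (frac-< a (suc b) (suc j) (suc k) cross)))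
    (frac-≤ 1 1 (suc k) (suc N) (ℕ.*-monoʳ-≤ 1 (ℕ.s≤s N≤k)))

  -- ⌊log₂ (n ^ m)⌋ / m at m = 1 + k
  log₂-approx : ℕ → ℕ → ℚ
  log₂-approx n k = + ⌊log₂ (n ℕ.^ suc k) ⌋ ℚ./ suc k

  log₂-approx-difference : ∀ n .{{_ : NonZero n}} N j k → N ℕ.≤ k →
    log₂-approx n j ℚ.- log₂-approx n k ℚ.< + 1 ℚ./ suc N
  log₂-approx-difference n N j k = frac-difference
    ⌊log₂ (n ℕ.^ suc j) ⌋ ⌊log₂ (n ℕ.^ suc k) ⌋ N j k (⌊log₂^⌋-cross n (suc j) (suc k))

  1≤log₂-approx : ∀ n k → 2 ℕ.≤ n → 1ℚ ℚ.≤ log₂-approx n k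
  1≤log₂-approx n k 2≤n = frac-≤ 1 l 1 (suc k) (begin
    1 ℕ.* suc k                ≡⟨ ℕ.*-identityˡ (suc k) ⟩
    suc k                      ≡⟨ ⌊log₂[2^n]⌋≡n (suc k) ⟨
    ⌊log₂ (2 ℕ.^ suc k) ⌋      ≤⟨ ⌊log₂⌋-mono-≤ (ℕ.^-monoˡ-≤ (suc k) 2≤n) ⟩
    l                          ≡⟨ ℕ.*-identityʳ l ⟨
    l ℕ.* 1                    ∎)
    where
    open ℕ.≤-Reasoning
    l = ⌊log₂ (n ℕ.^ suc k) ⌋

  sub-bound : ∀ p q r s {ε} → ℚ.∣ p ℚ.- q ∣ ℚ.< ½ ℚ.* ε → ℚ.∣ r ℚ.- s ∣ ℚ.< ½ ℚ.* ε →
              ℚ.∣ (p ℚ.- r) ℚ.- (q ℚ.- s) ∣ ℚ.< ε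
  sub-bound p q r s {ε} lt₁ lt₂ = begin-strict
    ℚ.∣ (p ℚ.- r) ℚ.- (q ℚ.- s) ∣
      ≡⟨ cong ℚ.∣_∣ (solve 4 (λ p q r s → (p :- r) :- (q :- s) := (p :- q) :- (r :- s)) refl p q r s) ⟩
    ℚ.∣ (p ℚ.- q) ℚ.- (r ℚ.- s) ∣           ≤⟨ ℚ.∣p-q∣≤∣p∣+∣q∣ (p ℚ.- q) (r ℚ.- s) ⟩
    ℚ.∣ p ℚ.- q ∣ ℚ.+ ℚ.∣ r ℚ.- s ∣         <⟨ ℚ.+-mono-< lt₁ lt₂ ⟩
    ½ ℚ.* ε ℚ.+ ½ ℚ.* ε                     ≡⟨ half+half ε ⟩
    ε                                       ∎
    where open ℚ.≤-Reasoning

  abs-bound : ∀ p q {ε} → ℚ.∣ p ℚ.- q ∣ ℚ.< ε → ℚ.∣ ℚ.∣ p ∣ ℚ.- ℚ.∣ q ∣ ∣ ℚ.< ε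
  abs-bound p q lt = abs-< (p-q<r (abs-abs p q lt))
    (subst (ℚ._< _) (swap ℚ.∣ q ∣ ℚ.∣ p ∣)
      (p-q<r (abs-abs q p (subst (ℚ._< _) (∣p-q∣≡∣q-p∣ p q) lt))))

  inv : ℚ → ℚ
  inv p with p ℚ.≟ 0ℚ
  ... | yes _   = 0ℚ
  ... | no  p≢0 = ℚ.1/_ p {{ℚ.≢-nonZero p≢0}}

  *-inv : ∀ p → 0ℚ ℚ.< p → p ℚ.* inv p ≡ 1ℚ
  *-inv p 0<p with p ℚ.≟ 0ℚ
  ... | yes refl = contradiction 0<p (ℚ.<-irrefl refl)
  ... | no  p≢0  = ℚ.*-inverseʳ p {{ℚ.≢-nonZero p≢0}}

  inv-pos : ∀ {p} → 0ℚ ℚ.< p → 0ℚ ℚ.< inv p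
  inv-pos {p} 0<p = ℚ.*-cancelˡ-<-nonNeg p {{ℚ.pos⇒nonNeg p {{ℚ.positive 0<p}}}}
    (subst₂ ℚ._<_ (sym (ℚ.*-zeroʳ p)) (sym (*-inv p 0<p)) (ℚ.positive⁻¹ 1ℚ))

  *-monoʳ-<′ : ∀ {p q r} → 0ℚ ℚ.< r → p ℚ.< q → r ℚ.* p ℚ.< r ℚ.* q
  *-monoʳ-<′ {r = r} 0<r = ℚ.*-monoʳ-<-pos r {{ℚ.positive 0<r}}

  *-mono-≤′ : ∀ {p q r s} → 0ℚ ℚ.≤ r → 0ℚ ℚ.≤ q → p ℚ.≤ q → r ℚ.≤ s → p ℚ.* r ℚ.≤ q ℚ.* s
  *-mono-≤′ {p} {q} {r} {s} 0≤r 0≤q p≤q r≤s = ℚ.≤-trans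
    (ℚ.*-monoʳ-≤-nonNeg r {{ℚ.nonNegative 0≤r}} p≤q)
    (ℚ.*-monoˡ-≤-nonNeg q {{ℚ.nonNegative 0≤q}} r≤s)

  mul-bound : ∀ p q r s {B C ε} → 0ℚ ℚ.< B → 0ℚ ℚ.< C → ℚ.∣ p ∣ ℚ.< B → ℚ.∣ s ∣ ℚ.< C →
              ℚ.∣ p ℚ.- q ∣ ℚ.< inv C ℚ.* (½ ℚ.* ε) → ℚ.∣ r ℚ.- s ∣ ℚ.< inv B ℚ.* (½ ℚ.* ε) →
              ℚ.∣ p ℚ.* r ℚ.- q ℚ.* s ∣ ℚ.< ε
  mul-bound p q r s {B} {C} {ε} 0<B 0<C p<B s<C lt₁ lt₂ = begin-strict
    ℚ.∣ p ℚ.* r ℚ.- q ℚ.* s ∣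
      ≡⟨ cong ℚ.∣_∣ (solve 4 (λ p q r s → p :* r :- q :* s := p :* (r :- s) :+ s :* (p :- q)) refl p q r s) ⟩
    ℚ.∣ p ℚ.* (r ℚ.- s) ℚ.+ s ℚ.* (p ℚ.- q) ∣
      ≤⟨ ℚ.∣p+q∣≤∣p∣+∣q∣ (p ℚ.* (r ℚ.- s)) (s ℚ.* (p ℚ.- q)) ⟩
    ℚ.∣ p ℚ.* (r ℚ.- s) ∣ ℚ.+ ℚ.∣ s ℚ.* (p ℚ.- q) ∣
      <⟨ ℚ.+-mono-< (part p (r ℚ.- s) 0<B p<B lt₂) (part s (p ℚ.- q) 0<C s<C lt₁) ⟩
    ½ ℚ.* ε ℚ.+ ½ ℚ.* ε
      ≡⟨ half+half ε ⟩
    ε ∎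
    where
    open ℚ.≤-Reasoning
    part : ∀ u v {D η} → 0ℚ ℚ.< D → ℚ.∣ u ∣ ℚ.< D → ℚ.∣ v ∣ ℚ.< inv D ℚ.* η → ℚ.∣ u ℚ.* v ∣ ℚ.< η
    part u v {D} {η} 0<D u<D v< = begin-strict
      ℚ.∣ u ℚ.* v ∣            ≡⟨ ℚ.∣p*q∣≡∣p∣*∣q∣ u v ⟩
      ℚ.∣ u ∣ ℚ.* ℚ.∣ v ∣      ≤⟨ ℚ.*-monoʳ-≤-nonNeg ℚ.∣ v ∣ {{ℚ.∣-∣-nonNeg v}} (ℚ.<⇒≤ u<D) ⟩
      D ℚ.* ℚ.∣ v ∣            <⟨ *-monoʳ-<′ 0<D v< ⟩
      D ℚ.* (inv D ℚ.* η)      ≡⟨ ℚ.*-assoc D (inv D) η ⟨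
      D ℚ.* inv D ℚ.* η        ≡⟨ cong (ℚ._* η) (*-inv D 0<D) ⟩
      1ℚ ℚ.* η                 ≡⟨ ℚ.*-identityˡ η ⟩
      η                        ∎

  inv-bound : ∀ p q {δ ε} → 0ℚ ℚ.< δ → δ ℚ.≤ p → δ ℚ.≤ q → ℚ.∣ p ℚ.- q ∣ ℚ.< δ ℚ.* δ ℚ.* ε →
              ℚ.∣ inv p ℚ.- inv q ∣ ℚ.< ε
  inv-bound p q {δ} {ε} 0<δ δ≤p δ≤q lt = ℚ.*-cancelˡ-<-nonNeg (δ ℚ.* δ) {{δδ≥0}} (begin-strict
    δ ℚ.* δ ℚ.* ℚ.∣ a ∣               ≤⟨ ℚ.*-monoʳ-≤-nonNeg ℚ.∣ a ∣ {{ℚ.∣-∣-nonNeg a}}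
                                         (*-mono-≤′ (ℚ.<⇒≤ 0<δ) (ℚ.<⇒≤ 0<p) δ≤p δ≤q) ⟩
    p ℚ.* q ℚ.* ℚ.∣ a ∣               ≡⟨ cong (ℚ._* ℚ.∣ a ∣) (ℚ.0≤p⇒∣p∣≡p (ℚ.<⇒≤ (*-pos 0<p 0<q))) ⟨
    ℚ.∣ p ℚ.* q ∣ ℚ.* ℚ.∣ a ∣         ≡⟨ ℚ.∣p*q∣≡∣p∣*∣q∣ (p ℚ.* q) a ⟨
    ℚ.∣ p ℚ.* q ℚ.* a ∣               ≡⟨ cong ℚ.∣_∣ rearrange ⟩
    ℚ.∣ q ℚ.- p ∣                     ≡⟨ ∣p-q∣≡∣q-p∣ q p ⟩
    ℚ.∣ p ℚ.- q ∣                     <⟨ lt ⟩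
    δ ℚ.* δ ℚ.* ε                     ∎)
    where
    open ℚ.≤-Reasoning
    a = inv p ℚ.- inv q
    0<p = ℚ.<-≤-trans 0<δ δ≤p
    0<q = ℚ.<-≤-trans 0<δ δ≤q
    δδ≥0 = ℚ.nonNegative (ℚ.<⇒≤ (*-pos 0<δ 0<δ))
    rearrange : p ℚ.* q ℚ.* a ≡ q ℚ.- p
    rearrange = trans
      (solve 4 (λ p q p′ q′ → p :* q :* (p′ :- q′) := (p :* p′) :* q :- (q :* q′) :* p)
        refl p q (inv p) (inv q))
      (cong₂ ℚ._-_ (trans (cong (ℚ._* q) (*-inv p 0<p)) (ℚ.*-identityˡ q))
                   (trans (cong (ℚ._* p) (*-inv q 0<q)) (ℚ.*-identityˡ p)))

open Estimates

record ℝ : Set where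
  field
    approx : ℕ → ℚ
    cauchy : ∀ ε → 0ℚ ℚ.< ε → ∃[ N ] (∀ i j → N ℕ.≤ i → N ℕ.≤ j →
             ℚ.∣ approx i ℚ.- approx j ∣ ℚ.< ε)

open ℝ

infix 4 _<_ _≤_

_<_ : ℝ → ℝ → Set
x < y = ∃[ ε ] (0ℚ ℚ.< ε × ∃[ N ] (∀ n → N ℕ.≤ n → approx x n ℚ.+ ε ℚ.≤ approx y n))

_≤_ : ℝ → ℝ → Set
x ≤ y = ¬ (y < x)

fromℚ : ℚ → ℝ
fromℚ q = record
  { approx = λ _ → q
  ; cauchy = λ ε 0<ε → 0 , λ _ _ _ _ →
      subst (ℚ._< ε) (cong ℚ.∣_∣ (sym (ℚ.+-inverseʳ q))) 0<ε
  }

fromℕ : ℕ → ℝ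
fromℕ n = fromℚ (+ n ℚ./ 1)

0ℝ 1ℝ : ℝ
0ℝ = fromℚ 0ℚ
1ℝ = fromℚ 1ℚ

infixl 6 _-_
infixl 7 _*_

_-_ : ℝ → ℝ → ℝ
x - y = record
  { approx = λ n → approx x n ℚ.- approx y n
  ; cauchy = λ ε 0<ε →
      let M , hx = cauchy x (½ ℚ.* ε) (half-pos 0<ε)
          N , hy = cauchy y (½ ℚ.* ε) (half-pos 0<ε)
      in M ℕ.⊔ N , λ i j p q → sub-bound (approx x i) (approx x j) (approx y i) (approx y j)
           (hx i j (ℕ.m⊔n≤o⇒m≤o M N p) (ℕ.m⊔n≤o⇒m≤o M N q))
           (hy i j (ℕ.m⊔n≤o⇒n≤o M N p) (ℕ.m⊔n≤o⇒n≤o M N q))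
  }

∣_∣ : ℝ → ℝ
∣ x ∣ = record
  { approx = λ n → ℚ.∣ approx x n ∣
  ; cauchy = λ ε 0<ε → let N , h = cauchy x ε 0<ε in
      N , λ i j p q → abs-bound (approx x i) (approx x j) (h i j p q)
  }

private
  bounded : ∀ x → ∃[ B ] (0ℚ ℚ.< B × ∃[ N ] (∀ n → N ℕ.≤ n → ℚ.∣ approx x n ∣ ℚ.< B))
  bounded x = let N , h = cauchy x 1ℚ (ℚ.positive⁻¹ 1ℚ) in
    ℚ.∣ approx x N ∣ ℚ.+ 1ℚ ,
    ℚ.+-mono-≤-< (ℚ.0≤∣p∣ (approx x N)) (ℚ.positive⁻¹ 1ℚ) ,
    N , λ n N≤n → abs-abs (approx x n) (approx x N) (h n N N≤n ℕ.≤-refl)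

_*_ : ℝ → ℝ → ℝ
x * y = record
  { approx = λ n → approx x n ℚ.* approx y n
  ; cauchy = λ ε 0<ε →
      let B , 0<B , K , hB = bounded x
          C , 0<C , L , hC = bounded y
          M , hx = cauchy x (inv C ℚ.* (½ ℚ.* ε)) (*-pos (inv-pos 0<C) (half-pos 0<ε))
          N , hy = cauchy y (inv B ℚ.* (½ ℚ.* ε)) (*-pos (inv-pos 0<B) (half-pos 0<ε))
          S = (K ℕ.⊔ L) ℕ.⊔ (M ℕ.⊔ N)
          KL = λ {n} (p : S ℕ.≤ n) → ℕ.m⊔n≤o⇒m≤o (K ℕ.⊔ L) (M ℕ.⊔ N) p
          MN = λ {n} (p : S ℕ.≤ n) → ℕ.m⊔n≤o⇒n≤o (K ℕ.⊔ L) (M ℕ.⊔ N) p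
      in S , λ i j p q → mul-bound (approx x i) (approx x j) (approx y i) (approx y j) 0<B 0<C
           (hB i (ℕ.m⊔n≤o⇒m≤o K L (KL p)))
           (hC j (ℕ.m⊔n≤o⇒n≤o K L (KL q)))
           (hx i j (ℕ.m⊔n≤o⇒m≤o M N (MN p)) (ℕ.m⊔n≤o⇒m≤o M N (MN q)))
           (hy i j (ℕ.m⊔n≤o⇒n≤o M N (MN p)) (ℕ.m⊔n≤o⇒n≤o M N (MN q)))
  }

-- inv 0ℚ = 0ℚ, but that value is used for finitely many terms only.
recip : (x : ℝ) → 0ℝ < x → ℝ
recip x (δ , 0<δ , M , h) = record
  { approx = λ n → inv (approx x n)
  ; cauchy = λ ε 0<ε →
      let N , hx = cauchy x (δ ℚ.* δ ℚ.* ε) (*-pos (*-pos 0<δ 0<δ) 0<ε)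
          δ≤ = λ n p → subst (ℚ._≤ approx x n) (ℚ.+-identityˡ δ) (h n (ℕ.m⊔n≤o⇒m≤o M N p))
      in M ℕ.⊔ N , λ i j p q → inv-bound (approx x i) (approx x j) 0<δ (δ≤ i p) (δ≤ j q)
           (hx i j (ℕ.m⊔n≤o⇒n≤o M N p) (ℕ.m⊔n≤o⇒n≤o M N q))
  }

infixl 7 _÷_⟨_⟩

_÷_⟨_⟩ : (x y : ℝ) → 0ℝ < y → ℝ
x ÷ y ⟨ 0<y ⟩ = x * recip y 0<y

-- With k = ⌊log₂ (n ^ m)⌋ one has 2 ^ k ≤ n ^ m < 2 ^ (k + 1), that is,
-- k / m ≤ log₂ n < k / m + 1 / m; the approximations are these k / m, m ≥ 1.
log₂ : (n : ℕ) .{{_ : NonZero n}} → ℝ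
log₂ n = record
  { approx = λ k → + ⌊log₂ (n ℕ.^ suc k) ⌋ ℚ./ suc k
  ; cauchy = λ ε 0<ε → let N , 1/N<ε = archimedean ε 0<ε in
      N , λ i j p q → ℚ.<-trans
        (abs-< {log₂-approx n i ℚ.- log₂-approx n j}
          (log₂-approx-difference n N i j q)
          (subst (ℚ._< + 1 ℚ./ suc N) (swap (log₂-approx n j) (log₂-approx n i))
            (log₂-approx-difference n N j i p)))
        1/N<ε
  }

0<log₂ : ∀ n → 0ℝ < log₂ (2 ℕ.+ n)
0<log₂ n = 1ℚ , ℚ.positive⁻¹ 1ℚ , 0 , λ k _ →
  subst (ℚ._≤ log₂-approx (2 ℕ.+ n) k) (sym (ℚ.+-identityˡ 1ℚ))
    (1≤log₂-approx (2 ℕ.+ n) k (ℕ.s≤s (ℕ.s≤s ℕ.z≤n)))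

infix 4 _⟶_

_⟶_ : (ℕ → ℝ) → ℝ → Set
a ⟶ x = ∀ ε → 0ℚ ℚ.< ε → ∃[ N ] (∀ n → N ℕ.≤ n → ∣ a n - x ∣ < fromℚ ε)

∑ : ℕ → (ℕ → ℚ) → ℚ
∑ zero    f = 0ℚ
∑ (suc n) f = ∑ n f ℚ.+ f n

record OpenInterval : Set where
  field
    lo hi : ℚ
    lo≤hi : lo ℚ.≤ hi

open OpenInterval

length : OpenInterval → ℚ
length I = hi I ℚ.- lo I

infix 4 _∈_

_∈_ : ℝ → OpenInterval → Set
x ∈ I = fromℚ (lo I) < x × x < fromℚ (hi I)

-- The exceptional set { x ∈ D : ¬ P x } is null: for every ε > 0 it is covered
-- by countably many intervals of total length at most ε.  The covering
-- condition is written contrapositively (a point of D outside every interval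
-- satisfies P), which is classically the same.
AlmostEvery : (D P : ℝ → Set) → Set
AlmostEvery D P = ∀ ε → 0ℚ ℚ.< ε → Σ[ I ∈ (ℕ → OpenInterval) ]
  ((∀ n → ∑ n (λ k → length (I k)) ℚ.≤ ε) ×
   (∀ x → D x → (∀ n → ¬ (x ∈ I n)) → P x))

⟨0,1] : ℝ → Set
⟨0,1] x = 0ℝ < x × x ≤ 1ℝ

2^-_ : ℕ → ℚ
2^- m = ℚ._/_ (+ 1) (2 ℕ.^ m) {{ℕ.m^n≢0 2 m}}

-- Digits are indexed from 0: d i is the digit dᵢ₊₁.
digitSum : (ℕ → ℕ) → ℕ → ℕ
digitSum d zero    = 0
digitSum d (suc n) = digitSum d n ℕ.+ d n

-- For x in (0,1] there is exactly one such d, so this is the graph of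
-- x ↦ (dᵢ(x))ᵢ; that function is discontinuous, hence not constructively
-- definable on ℝ.
record IsExpansion (d : ℕ → ℕ) (x : ℝ) : Set where
  field
    digit≥1 : ∀ i → 1 ℕ.≤ d i
    sum≡x   : (λ n → fromℚ (∑ n (λ i → 2^- digitSum d (suc i)))) ⟶ x

-- L d n = max { d₁, …, dₙ }
L : (ℕ → ℕ) → ℕ → ℕ
L d zero    = 0
L d (suc n) = L d n ℕ.⊔ d n

{-# OPTIONS --safe #-}
module Submission where

-- The digits of x are the gaps between successive ones of its non-terminating
-- binary expansion, that is, independent geometric variables of ratio ½.  Put
-- N = 2^(s²+s).  Some digit among d₁, …, d_N exceeds s²+2s with probability at
-- most N·2^-(s²+2s) = 2^-s, and none exceeds s² with probability
-- (1 - 2^-s²)^N ≤ 2^-s by Bernoulli's inequality.  Both bounds are summable, so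
-- off a set of small measure s² < L_N ≤ s²+2s for all s ≥ c.  Since L is
-- monotone and log₂ N increases by only 2s+2 from s to s+1, it follows that
-- |L_n - log₂ n| ≤ 3(s+1) for 2^(s²+s) ≤ n ≤ 2^((s+1)²+(s+1)), while log₂ n ≥ s(s+1).
--
-- The measure of the bad dyadic intervals is bounded by a potential on the
-- binary tree: a nonnegative function whose value at a node dominates the cost
-- of the node plus the mean of the values at its children.  Small
-- neighbourhoods of all dyadic rationals are removed as well, so that the
-- digits of the remaining x can be computed.

open import Algebra.Bundles using (CommutativeRing)
open import Data.Bool.Base using (Bool; true; false; if_then_else_; _∧_)
open import Data.Integer.Base using (+_)
open import Data.List.Base using (List; []; _∷_; _++_; concatMap)
open import Data.List.Membership.Propositional renaming (_∈_ to _∈ˡ_)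
open import Data.List.Membership.Propositional.Properties using (∈-++⁺ˡ; ∈-++⁺ʳ; ∈-concatMap⁺)
open import Data.List.Relation.Unary.Any as Any using (here; there)
open import Data.Nat.Base as ℕ using (ℕ; zero; suc; _+_; NonZero)
open import Data.Nat.Logarithm using (⌊log₂_⌋; ⌊log₂[2^n]⌋≡n; ⌊log₂⌋-mono-≤)
import Data.Nat.Properties as ℕ
open import Data.Nat.Tactic.RingSolver using (solve-∀)
open import Data.Product using (∃-syntax; _×_; _,_; proj₁; proj₂)
open import Data.Rational.Base as ℚ using (ℚ; 0ℚ; 1ℚ; ½)
import Data.Rational.Properties as ℚ
open import Data.Rational.Solver using (module +-*-Solver)
import Data.Rational.Unnormalised.Base as ℚᵘ
import Data.Rational.Unnormalised.Properties as ℚᵘ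
open import Data.Sum.Base using (_⊎_; inj₁; inj₂; [_,_]′)
open import Function.Base using (_∘_; id)
open import Function.Bundles using (mk⇔)
open import Relation.Binary.PropositionalEquality
open import Relation.Nullary using (¬_; contradiction)
open import Relation.Nullary.Decidable using (does-⇔; dec-true; _×-dec_)
open import Defs

open CommutativeRing ℚ.+-*-commutativeRing using (semiring)
open import Algebra.Properties.Semiring.Exp semiring using (_^_; ^-homo-*)
open import Algebra.Properties.Semiring.Mult semiring
  using (×-homo-+; ×-comm-*) renaming (_×_ to _•_)
open +-*-Solver using (solve; _:=_; _:+_; _:*_; _:-_; :-_; con)

open Estimates using (half+half; *-pos; half-pos; archimedean; frac-≤; frac-suc;
  log₂-approx; 1≤log₂-approx; inv; *-inv; inv-pos)
open ℝ
open OpenInterval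

-- Rational estimates

0≤1 : 0ℚ ℚ.≤ 1ℚ
0≤1 = ℚ.nonNegative⁻¹ 1ℚ

*-nonNeg : ∀ {p q} → 0ℚ ℚ.≤ p → 0ℚ ℚ.≤ q → 0ℚ ℚ.≤ p ℚ.* q
*-nonNeg {p} {q} 0≤p 0≤q = subst (ℚ._≤ p ℚ.* q) (ℚ.*-zeroʳ p)
  (ℚ.*-monoˡ-≤-nonNeg p {{ℚ.nonNegative 0≤p}} 0≤q)

*-monoˡ-≤ : ∀ {r p q} → 0ℚ ℚ.≤ r → p ℚ.≤ q → r ℚ.* p ℚ.≤ r ℚ.* q
*-monoˡ-≤ {r} 0≤r = ℚ.*-monoˡ-≤-nonNeg r {{ℚ.nonNegative 0≤r}}

+-nonNeg : ∀ {p q} → 0ℚ ℚ.≤ p → 0ℚ ℚ.≤ q → 0ℚ ℚ.≤ p ℚ.+ q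
+-nonNeg = ℚ.+-mono-≤

p≤p+q : ∀ p {q} → 0ℚ ℚ.≤ q → p ℚ.≤ p ℚ.+ q
p≤p+q p {q} 0≤q = subst (ℚ._≤ p ℚ.+ q) (ℚ.+-identityʳ p) (ℚ.+-monoʳ-≤ p 0≤q)

≤-by-difference : ∀ {p q} r → 0ℚ ℚ.≤ r → p ℚ.+ r ≡ q → p ℚ.≤ q
≤-by-difference {p} r 0≤r eq = subst (p ℚ.≤_) eq (p≤p+q p 0≤r)

½^-pos : ∀ n → 0ℚ ℚ.< ½ ^ n
½^-pos zero    = ℚ.positive⁻¹ 1ℚ
½^-pos (suc n) = half-pos (½^-pos n)

0≤½^ : ∀ n → 0ℚ ℚ.≤ ½ ^ n
0≤½^ n = ℚ.<⇒≤ (½^-pos n)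

½^-halves : ∀ n → ½ ^ suc n ℚ.+ ½ ^ suc n ≡ ½ ^ n
½^-halves n = half+half (½ ^ n)

½^-antimono : ∀ {m n} → m ℕ.≤ n → ½ ^ n ℚ.≤ ½ ^ m
½^-antimono {n = zero}  ℕ.z≤n = ℚ.≤-refl
½^-antimono {n = suc n} ℕ.z≤n = ℚ.≤-trans
  (subst (½ ^ suc n ℚ.≤_) (½^-halves n) (p≤p+q (½ ^ suc n) (0≤½^ (suc n))))
  (½^-antimono {0} {n} ℕ.z≤n)
½^-antimono (ℕ.s≤s m≤n) = *-monoˡ-≤ (ℚ.nonNegative⁻¹ ½) (½^-antimono m≤n)

1/2n≡½*1/n : ∀ n .{{_ : NonZero n}} .{{_ : NonZero (2 ℕ.* n)}} →
             + 1 ℚ./ (2 ℕ.* n) ≡ ½ ℚ.* (+ 1 ℚ./ n)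
1/2n≡½*1/n n@(suc _) = ℚ.toℚᵘ-injective (begin
  ℚ.toℚᵘ (+ 1 ℚ./ (2 ℕ.* n))             ≈⟨ ℚ.toℚᵘ-fromℚᵘ (+ 1 ℚᵘ./ (2 ℕ.* n)) ⟩
  + 1 ℚᵘ./ (2 ℕ.* n)                     ≈⟨ ℚᵘ.*≡* refl ⟩
  ℚ.toℚᵘ ½ ℚᵘ.* (+ 1 ℚᵘ./ n)             ≈⟨ ℚᵘ.*-congˡ {ℚ.toℚᵘ ½} (ℚ.toℚᵘ-fromℚᵘ (+ 1 ℚᵘ./ n)) ⟨
  ℚ.toℚᵘ ½ ℚᵘ.* ℚ.toℚᵘ (+ 1 ℚ./ n)       ≈⟨ ℚ.toℚᵘ-homo-* ½ (+ 1 ℚ./ n) ⟨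
  ℚ.toℚᵘ (½ ℚ.* (+ 1 ℚ./ n))             ∎)
  where open import Relation.Binary.Reasoning.Setoid ℚᵘ.≃-setoid

2^-≡½^ : ∀ n → 2^- n ≡ ½ ^ n
2^-≡½^ zero    = refl
2^-≡½^ (suc n) = trans
  (1/2n≡½*1/n (2 ℕ.^ n) {{ℕ.m^n≢0 2 n}} {{ℕ.m^n≢0 2 (suc n)}})
  (cong (½ ℚ.*_) (2^-≡½^ n))

n<2^n : ∀ n → n ℕ.< 2 ℕ.^ n
n<2^n zero    = ℕ.s≤s ℕ.z≤n
n<2^n (suc n) = begin-strict
  suc n                   <⟨ ℕ.s≤s (n<2^n n) ⟩
  1 + 2 ℕ.^ n             ≤⟨ ℕ.+-mono-≤ (ℕ.>-nonZero⁻¹ (2 ℕ.^ n) {{ℕ.m^n≢0 2 n}})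
                                         (ℕ.≤-reflexive (sym (ℕ.+-identityʳ _))) ⟩
  2 ℕ.^ suc n             ∎
  where open ℕ.≤-Reasoning

½^-archimedean : ∀ ε → 0ℚ ℚ.< ε → ∃[ n ] ½ ^ n ℚ.≤ ε
½^-archimedean ε 0<ε with N , 1/N<ε ← archimedean ε 0<ε =
  N , ℚ.≤-trans (subst (ℚ._≤ + 1 ℚ./ suc N) (2^-≡½^ N)
        (frac-≤ 1 1 (2 ℕ.^ N) (suc N) {{ℕ.m^n≢0 2 N}} (ℕ.*-monoʳ-≤ 1 (n<2^n N))))
      (ℚ.<⇒≤ 1/N<ε)

-- The factor `p` serves the induction, which passes from `p` to `½ ℚ.* p`.
2^n•½^n : ∀ n p → (2 ℕ.^ n) • (½ ^ n ℚ.* p) ≡ p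
2^n•½^n zero    p = trans (ℚ.+-identityʳ _) (ℚ.*-identityˡ p)
2^n•½^n (suc n) p = begin
  (2 ℕ.^ n + (2 ℕ.^ n + 0)) • q
    ≡⟨ ×-homo-+ q (2 ℕ.^ n) (2 ℕ.^ n + 0) ⟩
  (2 ℕ.^ n) • q ℚ.+ (2 ℕ.^ n + 0) • q
    ≡⟨ cong (λ m → (2 ℕ.^ n) • q ℚ.+ m • q) (ℕ.+-identityʳ (2 ℕ.^ n)) ⟩
  (2 ℕ.^ n) • q ℚ.+ (2 ℕ.^ n) • q
    ≡⟨ cong (λ r → (2 ℕ.^ n) • r ℚ.+ (2 ℕ.^ n) • r)
         (solve 2 (λ h p → con ½ :* h :* p := h :* (con ½ :* p)) refl (½ ^ n) p) ⟩
  (2 ℕ.^ n) • (½ ^ n ℚ.* (½ ℚ.* p)) ℚ.+ (2 ℕ.^ n) • (½ ^ n ℚ.* (½ ℚ.* p))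
    ≡⟨ cong₂ ℚ._+_ (2^n•½^n n (½ ℚ.* p)) (2^n•½^n n (½ ℚ.* p)) ⟩
  ½ ℚ.* p ℚ.+ ½ ℚ.* p
    ≡⟨ half+half p ⟩
  p ∎
  where
  open ≡-Reasoning
  q = ½ ^ suc n ℚ.* p

•-nonNeg : ∀ n {p} → 0ℚ ℚ.≤ p → 0ℚ ℚ.≤ n • p
•-nonNeg zero    0≤p = ℚ.≤-refl
•-nonNeg (suc n) 0≤p = +-nonNeg 0≤p (•-nonNeg n 0≤p)

^-nonNeg : ∀ {p} n → 0ℚ ℚ.≤ p → 0ℚ ℚ.≤ p ^ n
^-nonNeg zero    0≤p = 0≤1
^-nonNeg (suc n) 0≤p = *-nonNeg 0≤p (^-nonNeg n 0≤p)

-- The product form avoids division. In the step, (1 - x)(1 + x + nx) = 1 + nx - x(x + nx), and the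
-- subtracted term is nonnegative.
bernoulli : ∀ {x} → 0ℚ ℚ.≤ x → 0ℚ ℚ.≤ 1ℚ ℚ.- x → ∀ n →
            (1ℚ ℚ.- x) ^ n ℚ.* (1ℚ ℚ.+ n • x) ℚ.≤ 1ℚ
bernoulli 0≤x 0≤1-x zero = ℚ.≤-refl
bernoulli {x} 0≤x 0≤1-x (suc n) = begin
  (1ℚ ℚ.- x) ℚ.* y ℚ.* (1ℚ ℚ.+ (x ℚ.+ t))
    ≡⟨ solve 3 (λ x y t → (con 1ℚ :- x) :* y :* (con 1ℚ :+ (x :+ t))
                       := y :* ((con 1ℚ :+ t) :- x :* (x :+ t))) refl x y t ⟩
  y ℚ.* ((1ℚ ℚ.+ t) ℚ.- x ℚ.* (x ℚ.+ t))
    ≤⟨ *-monoˡ-≤ (^-nonNeg n 0≤1-x) (≤-by-difference (x ℚ.* (x ℚ.+ t))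
         (*-nonNeg 0≤x (+-nonNeg 0≤x (•-nonNeg n 0≤x)))
         (solve 2 (λ a b → a :- b :+ b := a) refl (1ℚ ℚ.+ t) (x ℚ.* (x ℚ.+ t)))) ⟩
  y ℚ.* (1ℚ ℚ.+ t)
    ≤⟨ bernoulli 0≤x 0≤1-x n ⟩
  1ℚ ∎
  where
  open ℚ.≤-Reasoning
  y = (1ℚ ℚ.- x) ^ n
  t = n • x

0≤1-½^ : ∀ k → 0ℚ ℚ.≤ 1ℚ ℚ.- ½ ^ k
0≤1-½^ k = subst (ℚ._≤ 1ℚ ℚ.- ½ ^ k) (ℚ.+-inverseʳ (½ ^ k))
  (ℚ.+-monoˡ-≤ (ℚ.- ½ ^ k) (½^-antimono {0} {k} ℕ.z≤n))

-- The 2^(k+s) copies of 2^-k add up to 2^s, so Bernoulli's inequality gives y(1 + 2^s) ≤ 1 for the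
-- power y; multiplying by 2^-s leaves y + y 2^-s ≤ 2^-s.
1-½^-power : ∀ k s → (1ℚ ℚ.- ½ ^ k) ^ (2 ℕ.^ (k + s)) ℚ.≤ ½ ^ s
1-½^-power k s = begin
  y                                                  ≤⟨ p≤p+q y (*-nonNeg 0≤y (0≤½^ s)) ⟩
  y ℚ.+ y ℚ.* ½ ^ s                                  ≡⟨ rearrange ⟩
  ½ ^ s ℚ.* (y ℚ.* (1ℚ ℚ.+ N • ½ ^ k))               ≤⟨ *-monoˡ-≤ (0≤½^ s)
                                                        (bernoulli (0≤½^ k) (0≤1-½^ k) N) ⟩
  ½ ^ s ℚ.* 1ℚ                                       ≡⟨ ℚ.*-identityʳ (½ ^ s) ⟩
  ½ ^ s                                              ∎
  where
  open ℚ.≤-Reasoning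
  N = 2 ℕ.^ (k + s)
  y = (1ℚ ℚ.- ½ ^ k) ^ N
  0≤y = ^-nonNeg N (0≤1-½^ k)
  one : ½ ^ s ℚ.* N • ½ ^ k ≡ 1ℚ
  one = trans (×-comm-* N (½ ^ s) (½ ^ k)) (trans
    (cong (N •_) (trans (ℚ.*-comm (½ ^ s) (½ ^ k)) (trans (sym (^-homo-* ½ k s)) (sym (ℚ.*-identityʳ _)))))
    (2^n•½^n (k + s) 1ℚ))
  rearrange : y ℚ.+ y ℚ.* ½ ^ s ≡ ½ ^ s ℚ.* (y ℚ.* (1ℚ ℚ.+ N • ½ ^ k))
  rearrange = sym (trans
    (solve 3 (λ h y t → h :* (y :* (con 1ℚ :+ t)) := y :* (h :* t) :+ y :* h)
      refl (½ ^ s) y (N • ½ ^ k))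
    (cong (ℚ._+ y ℚ.* ½ ^ s) (trans (cong (y ℚ.*_) one) (ℚ.*-identityʳ y))))

∑-cons : ∀ n f → ∑ (suc n) f ≡ f 0 ℚ.+ ∑ n (λ k → f (suc k))
∑-cons zero    f = ℚ.+-comm 0ℚ (f 0)
∑-cons (suc n) f = trans (cong (ℚ._+ f (suc n)) (∑-cons n f)) (ℚ.+-assoc (f 0) _ _)

∑-+ : ∀ n f g → ∑ n (λ k → f k ℚ.+ g k) ≡ ∑ n f ℚ.+ ∑ n g
∑-+ zero    f g = refl
∑-+ (suc n) f g = trans (cong (ℚ._+ (f n ℚ.+ g n)) (∑-+ n f g))
  (solve 4 (λ a b c d → a :+ b :+ (c :+ d) := a :+ c :+ (b :+ d)) refl (∑ n f) (∑ n g) (f n) (g n))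

∑-mono-≤ : ∀ n {f g} → (∀ k → f k ℚ.≤ g k) → ∑ n f ℚ.≤ ∑ n g
∑-mono-≤ zero    f≤g = ℚ.≤-refl
∑-mono-≤ (suc n) f≤g = ℚ.+-mono-≤ (∑-mono-≤ n f≤g) (f≤g n)

∑-geometric : ∀ c n → ∑ n (λ r → ½ ^ (r + c)) ℚ.≤ ½ ^ c ℚ.+ ½ ^ c
∑-geometric c n = ≤-by-difference (½ ^ n ℚ.* (½ ^ c ℚ.+ ½ ^ c))
  (*-nonNeg (0≤½^ n) (+-nonNeg (0≤½^ c) (0≤½^ c))) (closed n)
  where
  closed : ∀ n → ∑ n (λ r → ½ ^ (r + c)) ℚ.+ ½ ^ n ℚ.* (½ ^ c ℚ.+ ½ ^ c) ≡ ½ ^ c ℚ.+ ½ ^ c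
  closed zero    = trans (ℚ.+-identityˡ _) (ℚ.*-identityˡ _)
  closed (suc n) = trans
    (cong (λ p → ∑ n (λ r → ½ ^ (r + c)) ℚ.+ p ℚ.+ ½ ^ suc n ℚ.* (½ ^ c ℚ.+ ½ ^ c)) (^-homo-* ½ n c))
    (trans
      (solve 3 (λ S h e → S :+ h :* e :+ con ½ :* h :* (e :+ e) := S :+ h :* (e :+ e))
        refl (∑ n (λ r → ½ ^ (r + c))) (½ ^ n) (½ ^ c))
      (closed n))

-- Enumerating countable families of intervals

private variable A B : Set

total : (A → ℚ) → List A → ℚ
total f []       = 0ℚ
total f (x ∷ xs) = f x ℚ.+ total f xs

total-++ : ∀ (f : A → ℚ) xs ys → total f (xs ++ ys) ≡ total f xs ℚ.+ total f ys
total-++ f []       ys = sym (ℚ.+-identityˡ _)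
total-++ f (x ∷ xs) ys = trans (cong (f x ℚ.+_) (total-++ f xs ys)) (sym (ℚ.+-assoc (f x) _ _))

total-concatMap : ∀ (f : B → ℚ) (g : A → List B) xs →
                  total f (concatMap g xs) ≡ total (total f ∘ g) xs
total-concatMap f g []       = refl
total-concatMap f g (x ∷ xs) = trans (total-++ f (g x) (concatMap g xs))
  (cong (total f (g x) ℚ.+_) (total-concatMap f g xs))

total-cong : ∀ {f g : A → ℚ} → (∀ x → f x ≡ g x) → ∀ xs → total f xs ≡ total g xs
total-cong f≡g []       = refl
total-cong f≡g (x ∷ xs) = cong₂ ℚ._+_ (f≡g x) (total-cong f≡g xs)

total-mono-≤ : ∀ {f g : A → ℚ} → (∀ x → f x ℚ.≤ g x) → ∀ xs → total f xs ℚ.≤ total g xs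
total-mono-≤ f≤g []       = ℚ.≤-refl
total-mono-≤ f≤g (x ∷ xs) = ℚ.+-mono-≤ (f≤g x) (total-mono-≤ f≤g xs)

total-nonNeg : ∀ {f : A → ℚ} → (∀ x → 0ℚ ℚ.≤ f x) → ∀ xs → 0ℚ ℚ.≤ total f xs
total-nonNeg 0≤f []       = ℚ.≤-refl
total-nonNeg 0≤f (x ∷ xs) = +-nonNeg (0≤f x) (total-nonNeg 0≤f xs)

total-+ : ∀ (f g : A → ℚ) xs → total (λ x → f x ℚ.+ g x) xs ≡ total f xs ℚ.+ total g xs
total-+ f g []       = refl
total-+ f g (x ∷ xs) = trans (cong (f x ℚ.+ g x ℚ.+_) (total-+ f g xs))
  (solve 4 (λ a b c d → a :+ b :+ (c :+ d) := a :+ c :+ (b :+ d)) refl (f x) (g x) (total f xs) (total g xs))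

total-* : ∀ c (f : A → ℚ) xs → total (λ x → c ℚ.* f x) xs ≡ c ℚ.* total f xs
total-* c f []       = sym (ℚ.*-zeroʳ c)
total-* c f (x ∷ xs) = trans (cong (c ℚ.* f x ℚ.+_) (total-* c f xs)) (sym (ℚ.*-distribˡ-+ c (f x) _))

diagonal : (ℕ → ℕ → List A) → ℕ → List A
diagonal f zero    = f 0 0
diagonal f (suc n) = f 0 (suc n) ++ diagonal (f ∘ suc) n

∈-diagonal : ∀ (f : ℕ → ℕ → List A) {x} r n → x ∈ˡ f r n → x ∈ˡ diagonal f (r + n)
∈-diagonal f zero    zero    x∈ = x∈
∈-diagonal f zero    (suc n) x∈ = ∈-++⁺ˡ x∈
∈-diagonal f (suc r) n       x∈ = ∈-++⁺ʳ (f 0 (suc (r + n))) (∈-diagonal (f ∘ suc) r n x∈)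

-- The first n antidiagonals meet only the rows r < n, each in an initial segment, and `b r` bounds
-- every initial segment of row r.
∑-diagonal : ∀ (w : A → ℚ) (f : ℕ → ℕ → List A) b →
             (∀ r n → ∑ n (total w ∘ f r) ℚ.≤ b r) →
             ∀ n → ∑ n (total w ∘ diagonal f) ℚ.≤ ∑ n b
∑-diagonal w f b f≤b zero    = ℚ.≤-refl
∑-diagonal w f b f≤b (suc n) = begin
  ∑ (suc n) (total w ∘ diagonal f)
    ≡⟨ split n ⟩
  ∑ (suc n) (total w ∘ f 0) ℚ.+ ∑ n (total w ∘ diagonal (f ∘ suc))
    ≤⟨ ℚ.+-mono-≤ (f≤b 0 (suc n)) (∑-diagonal w (f ∘ suc) (b ∘ suc) (f≤b ∘ suc) n) ⟩
  b 0 ℚ.+ ∑ n (b ∘ suc)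
    ≡⟨ ∑-cons n b ⟨
  ∑ (suc n) b ∎
  where
  open ℚ.≤-Reasoning
  split : ∀ n → ∑ (suc n) (total w ∘ diagonal f) ≡
                ∑ (suc n) (total w ∘ f 0) ℚ.+ ∑ n (total w ∘ diagonal (f ∘ suc))
  split zero    = sym (ℚ.+-identityʳ _)
  split (suc n) = trans
    (cong₂ ℚ._+_ (split n) (total-++ w (f 0 (suc n)) (diagonal (f ∘ suc) n)))
    (solve 4 (λ a b c d → a :+ b :+ (c :+ d) := a :+ c :+ (b :+ d)) refl
      (∑ (suc n) (total w ∘ f 0)) (∑ n (total w ∘ diagonal (f ∘ suc)))
      (total w (f 0 (suc n))) (total w (diagonal (f ∘ suc) n)))

0≤length : ∀ I → 0ℚ ℚ.≤ length I
0≤length I = subst (ℚ._≤ length I) (ℚ.+-inverseʳ (lo I)) (ℚ.+-monoˡ-≤ (ℚ.- lo I) (lo≤hi I))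

∅ : OpenInterval
∅ = record { lo = 0ℚ ; hi = 0ℚ ; lo≤hi = ℚ.≤-refl }

-- ∅ is emitted whenever a list is exhausted.
enumerate : List OpenInterval → (ℕ → List OpenInterval) → ℕ → OpenInterval
enumerate []       f zero    = ∅
enumerate []       f (suc n) = enumerate (f 0) (f ∘ suc) n
enumerate (I ∷ Is) f zero    = I
enumerate (I ∷ Is) f (suc n) = enumerate Is f n

-- A list is opened only by a step that emits `∅`, so n steps reach no list beyond the first n of
-- `f`.
enumerate-length : ∀ n Is f → ∑ n (length ∘ enumerate Is f) ℚ.≤
                   total length Is ℚ.+ ∑ n (total length ∘ f)
enumerate-length zero    Is f = +-nonNeg (total-nonNeg 0≤length Is) ℚ.≤-refl
enumerate-length (suc n) [] f = begin
  ∑ (suc n) (length ∘ enumerate [] f)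
    ≡⟨ ∑-cons n _ ⟩
  0ℚ ℚ.+ ∑ n (length ∘ enumerate (f 0) (f ∘ suc))
    ≤⟨ ℚ.+-monoʳ-≤ 0ℚ (enumerate-length n (f 0) (f ∘ suc)) ⟩
  0ℚ ℚ.+ (total length (f 0) ℚ.+ ∑ n (total length ∘ f ∘ suc))
    ≡⟨ cong (0ℚ ℚ.+_) (∑-cons n (total length ∘ f)) ⟨
  0ℚ ℚ.+ ∑ (suc n) (total length ∘ f) ∎
  where open ℚ.≤-Reasoning
enumerate-length (suc n) (I ∷ Is) f = begin
  ∑ (suc n) (length ∘ enumerate (I ∷ Is) f)
    ≡⟨ ∑-cons n _ ⟩
  length I ℚ.+ ∑ n (length ∘ enumerate Is f)
    ≤⟨ ℚ.+-monoʳ-≤ (length I) (enumerate-length n Is f) ⟩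
  length I ℚ.+ (total length Is ℚ.+ ∑ n (total length ∘ f))
    ≡⟨ ℚ.+-assoc (length I) _ _ ⟨
  total length (I ∷ Is) ℚ.+ ∑ n (total length ∘ f)
    ≤⟨ ℚ.+-monoʳ-≤ (total length (I ∷ Is)) (p≤p+q _ (total-nonNeg 0≤length (f n))) ⟩
  total length (I ∷ Is) ℚ.+ ∑ (suc n) (total length ∘ f) ∎
  where open ℚ.≤-Reasoning

enumerate-head : ∀ {I} Is f → I ∈ˡ Is → ∃[ n ] enumerate Is f n ≡ I
enumerate-head (_ ∷ Is) f (here refl) = 0 , refl
enumerate-head (_ ∷ Is) f (there I∈)  with n , eq ← enumerate-head Is f I∈ = suc n , eq

enumerate-complete : ∀ {I} Is f ℓ → I ∈ˡ f ℓ → ∃[ n ] enumerate Is f n ≡ I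
enumerate-complete (_ ∷ Is) f ℓ I∈ with n , eq ← enumerate-complete Is f ℓ I∈ = suc n , eq
enumerate-complete [] f zero    I∈ with n , eq ← enumerate-head (f 0) (f ∘ suc) I∈ = suc n , eq
enumerate-complete [] f (suc ℓ) I∈ with n , eq ← enumerate-complete (f 0) (f ∘ suc) ℓ I∈ = suc n , eq

-- The binary tree and its potentials

-- A dyadic interval [left, left + 2^-ℓ] of level ℓ, read as a binary prefix of
-- length ℓ with `ones` ones, the last of them followed by `zeros` zeros;
-- `longest` is the largest digit completed so far.
record Node : Set where
  constructor node
  field
    ones zeros longest : ℕ
    left               : ℚ

open Node

children : ℕ → Node → List Node
children ℓ (node i z l a) = node i (suc z) l a ∷ node (suc i) 0 (l ℕ.⊔ suc z) (a ℚ.+ ½ ^ suc ℓ) ∷ []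

root : Node
root = node 0 0 0 0ℚ

nodes : ℕ → List Node
nodes zero    = root ∷ []
nodes (suc ℓ) = concatMap (children ℓ) (nodes ℓ)

child-∈ : ∀ {ℓ v w} → v ∈ˡ nodes ℓ → w ∈ˡ children ℓ v → w ∈ˡ nodes (suc ℓ)
child-∈ {ℓ} {w = w} v∈ w∈ = ∈-concatMap⁺ (children ℓ)
  (Any.map (λ eq → subst (λ u → w ∈ˡ children ℓ u) eq w∈) v∈)

-- A supermartingale for fair coin tossing: the factor ½ is the probability of each child given its
-- parent.
record Potential (cost : ℕ → Node → ℚ) : Set where
  field
    φ      : ℕ → Node → ℚ
    0≤φ    : ∀ ℓ v → 0ℚ ℚ.≤ φ ℓ v
    descent : ∀ ℓ v → cost ℓ v ℚ.+ ½ ℚ.* total (φ (suc ℓ)) (children ℓ v) ℚ.≤ φ ℓ v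

open Potential

_⊕_ : ∀ {c d} → Potential c → Potential d → Potential (λ ℓ v → c ℓ v ℚ.+ d ℓ v)
_⊕_ {c} {d} P Q = record
  { φ       = λ ℓ v → φ P ℓ v ℚ.+ φ Q ℓ v
  ; 0≤φ     = λ ℓ v → +-nonNeg (0≤φ P ℓ v) (0≤φ Q ℓ v)
  ; descent = λ ℓ v → subst (ℚ._≤ φ P ℓ v ℚ.+ φ Q ℓ v) (regroup ℓ v)
      (ℚ.+-mono-≤ (descent P ℓ v) (descent Q ℓ v))
  }
  where
  regroup : ∀ ℓ v → (c ℓ v ℚ.+ ½ ℚ.* total (φ P (suc ℓ)) (children ℓ v)) ℚ.+
                    (d ℓ v ℚ.+ ½ ℚ.* total (φ Q (suc ℓ)) (children ℓ v)) ≡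
                    (c ℓ v ℚ.+ d ℓ v) ℚ.+
                    ½ ℚ.* total (λ w → φ P (suc ℓ) w ℚ.+ φ Q (suc ℓ) w) (children ℓ v)
  regroup ℓ v = trans
    (solve 4 (λ a x b y → (a :+ con ½ :* x) :+ (b :+ con ½ :* y) := (a :+ b) :+ con ½ :* (x :+ y))
      refl (c ℓ v) (total (φ P (suc ℓ)) (children ℓ v)) (d ℓ v) (total (φ Q (suc ℓ)) (children ℓ v)))
    (cong (λ t → c ℓ v ℚ.+ d ℓ v ℚ.+ ½ ℚ.* t) (sym (total-+ (φ P (suc ℓ)) (φ Q (suc ℓ)) (children ℓ v))))

-- The cost of the levels below n plus 2^-n times the potential on level n never grows with n. At n
-- = 0 it is the potential of the root, and the second summand is nonnegative.
∑-cost≤potential : ∀ {cost} (P : Potential cost) n →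
                   ∑ n (λ ℓ → ½ ^ ℓ ℚ.* total (cost ℓ) (nodes ℓ)) ℚ.≤ φ P 0 root
∑-cost≤potential {cost} P n = ℚ.≤-trans
  (p≤p+q _ (*-nonNeg (0≤½^ n) (total-nonNeg (0≤φ P n) (nodes n)))) (invariant n)
  where
  open ℚ.≤-Reasoning
  invariant : ∀ n → ∑ n (λ ℓ → ½ ^ ℓ ℚ.* total (cost ℓ) (nodes ℓ)) ℚ.+
                    ½ ^ n ℚ.* total (φ P n) (nodes n) ℚ.≤ φ P 0 root
  invariant zero    = ℚ.≤-reflexive
    (solve 1 (λ p → con 0ℚ :+ con 1ℚ :* (p :+ con 0ℚ) := p) refl (φ P 0 root))
  invariant (suc n) = begin
    S ℚ.+ ½ ^ n ℚ.* total (cost n) (nodes n) ℚ.+ ½ ^ suc n ℚ.* total (φ P (suc n)) (nodes (suc n))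
      ≡⟨ cong (λ t → S ℚ.+ ½ ^ n ℚ.* total (cost n) (nodes n) ℚ.+ ½ ^ suc n ℚ.* t)
           (total-concatMap (φ P (suc n)) (children n) (nodes n)) ⟩
    S ℚ.+ ½ ^ n ℚ.* C ℚ.+ ½ ^ suc n ℚ.* D
      ≡⟨ solve 4 (λ S h C D → S :+ h :* C :+ con ½ :* h :* D := S :+ h :* (C :+ con ½ :* D))
           refl S (½ ^ n) C D ⟩
    S ℚ.+ ½ ^ n ℚ.* (C ℚ.+ ½ ℚ.* D)
      ≡⟨ cong (λ t → S ℚ.+ ½ ^ n ℚ.* t) (trans
           (cong (C ℚ.+_) (sym (total-* ½ _ (nodes n)))) (sym (total-+ (cost n) _ (nodes n)))) ⟩
    S ℚ.+ ½ ^ n ℚ.* total (λ v → cost n v ℚ.+ ½ ℚ.* total (φ P (suc n)) (children n v)) (nodes n)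
      ≤⟨ ℚ.+-monoʳ-≤ S (*-monoˡ-≤ (0≤½^ n) (total-mono-≤ (descent P n) (nodes n))) ⟩
    S ℚ.+ ½ ^ n ℚ.* total (φ P n) (nodes n)
      ≤⟨ invariant n ⟩
    φ P 0 root ∎
    where
    S = ∑ n (λ ℓ → ½ ^ ℓ ℚ.* total (cost ℓ) (nodes ℓ))
    C = total (cost n) (nodes n)
    D = total (λ v → total (φ P (suc n)) (children n v)) (nodes n)

-- Potentials for overlong digits and for the absence of long digits

𝟙 : Bool → ℚ
𝟙 b = if b then 1ℚ else 0ℚ

0≤𝟙 : ∀ b → 0ℚ ℚ.≤ 𝟙 b
0≤𝟙 true  = 0≤1
0≤𝟙 false = ℚ.≤-refl

𝟙-∧ : ∀ b c → 𝟙 (b ∧ c) ≡ 𝟙 b ℚ.* 𝟙 c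
𝟙-∧ true  c = sym (ℚ.*-identityˡ (𝟙 c))
𝟙-∧ false c = sym (ℚ.*-zeroˡ (𝟙 c))

-- m is the number of digits missing to N.
tooLong : (K m z : ℕ) → Bool
tooLong K zero    z = false
tooLong K (suc m) z = z ℕ.≡ᵇ K

-- The probability that the current digit, with z zeros read so far, will still
-- pass through the state of exactly K zeros (the present state included).
reach : (K z : ℕ) → ℚ
reach zero    zero    = 1ℚ
reach zero    (suc z) = 0ℚ
reach (suc K) zero    = ½ ℚ.* reach K zero
reach (suc K) (suc z) = reach K z

reach-0 : ∀ K → reach K 0 ≡ ½ ^ K
reach-0 zero    = refl
reach-0 (suc K) = cong (½ ℚ.*_) (reach-0 K)

0≤reach : ∀ K z → 0ℚ ℚ.≤ reach K z
0≤reach zero    zero    = 0≤1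
0≤reach zero    (suc z) = ℚ.≤-refl
0≤reach (suc K) zero    = *-nonNeg (ℚ.nonNegative⁻¹ ½) (0≤reach K zero)
0≤reach (suc K) (suc z) = 0≤reach K z

reach-suc : ∀ K z → 𝟙 (z ℕ.≡ᵇ K) ℚ.+ ½ ℚ.* reach K (suc z) ≡ reach K z
reach-suc zero    zero    = refl
reach-suc zero    (suc z) = refl
reach-suc (suc K) zero    = ℚ.+-identityˡ _
reach-suc (suc K) (suc z) = reach-suc K z

-- The expected number of digits, from the current one to the N-th, that pass through K zeros: the
-- current digit counts with `reach K z`, each later one with `reach K 0`.
tooLongPotential : (K m z : ℕ) → ℚ
tooLongPotential K zero    z = 0ℚ
tooLongPotential K (suc m) z = reach K z ℚ.+ m • reach K 0

tooLongPotential-0 : ∀ K m → tooLongPotential K m 0 ≡ m • reach K 0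
tooLongPotential-0 K zero    = refl
tooLongPotential-0 K (suc m) = refl

-- A zero leaves the number of missing digits unchanged, a one starts the next digit with one fewer
-- missing. The mean over both reproduces the terms of the later digits, and `reach-suc` accounts
-- for the current one.
tooLong-descent : ∀ K m z → 𝟙 (tooLong K m z) ℚ.+
  ½ ℚ.* (tooLongPotential K m (suc z) ℚ.+ (tooLongPotential K (ℕ.pred m) 0 ℚ.+ 0ℚ)) ≡
  tooLongPotential K m z
tooLong-descent K zero    z = refl
tooLong-descent K (suc m) z = begin
  t ℚ.+ ½ ℚ.* (r ℚ.+ M ℚ.+ (tooLongPotential K m 0 ℚ.+ 0ℚ))
    ≡⟨ cong (λ p → t ℚ.+ ½ ℚ.* (r ℚ.+ M ℚ.+ (p ℚ.+ 0ℚ))) (tooLongPotential-0 K m) ⟩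
  t ℚ.+ ½ ℚ.* (r ℚ.+ M ℚ.+ (M ℚ.+ 0ℚ))
    ≡⟨ solve 3 (λ t r M → t :+ con ½ :* (r :+ M :+ (M :+ con 0ℚ)) := t :+ con ½ :* r :+ M) refl t r M ⟩
  t ℚ.+ ½ ℚ.* r ℚ.+ M
    ≡⟨ cong (ℚ._+ M) (reach-suc K z) ⟩
  reach K z ℚ.+ M ∎
  where
  open ≡-Reasoning
  t = 𝟙 (z ℕ.≡ᵇ K)
  r = reach K (suc z)
  M = m • reach K 0

0≤tooLongPotential : ∀ K m z → 0ℚ ℚ.≤ tooLongPotential K m z
0≤tooLongPotential K zero    z = ℚ.≤-refl
0≤tooLongPotential K (suc m) z = +-nonNeg (0≤reach K z) (•-nonNeg m (0≤reach K 0))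

-- m is one more than the number of digits missing to N, so that m = 0 can
-- stand for the nodes past the N-th digit.
allShort : (k m z l : ℕ) → Bool
allShort k 1 zero l = l ℕ.≤ᵇ k
allShort k _ _    l = false

-- The probability that the current digit, with z zeros read so far, ends up at most k: a one must
-- occur among the next k - z bits. Truncated subtraction yields 0 for z ≥ k.
short : (k z : ℕ) → ℚ
short k z = 1ℚ ℚ.- ½ ^ (k ℕ.∸ z)

short-suc : ∀ k z → ½ ℚ.* (short k (suc z) ℚ.+ 𝟙 (z ℕ.<ᵇ k)) ≡ short k z
short-suc zero    zero    = refl
short-suc zero    (suc z) = refl
short-suc (suc k) zero    = solve 1 (λ h → con ½ :* (con 1ℚ :- h :+ con 1ℚ) := con 1ℚ :- con ½ :* h) refl (½ ^ k)
short-suc (suc k) (suc z) = short-suc k z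

-- The probability that the missing digits up to the N-th are all at most k. The value 1 belongs to
-- the node that ends in the N-th one, where the cost is charged; all later nodes have 0, so it is
-- charged only once.
allShortPotential : (k m z : ℕ) → ℚ
allShortPotential k 0             z       = 0ℚ
allShortPotential k 1             zero    = 1ℚ
allShortPotential k 1             (suc z) = 0ℚ
allShortPotential k (suc (suc m)) z       = short k z ℚ.* short k 0 ^ m

0≤allShortPotential : ∀ k m z → 0ℚ ℚ.≤ allShortPotential k m z
0≤allShortPotential k 0             z       = ℚ.≤-refl
0≤allShortPotential k 1             zero    = 0≤1
0≤allShortPotential k 1             (suc z) = ℚ.≤-refl
0≤allShortPotential k (suc (suc m)) z       = *-nonNeg (0≤1-½^ (k ℕ.∸ z)) (^-nonNeg m (0≤1-½^ k))

allShortPotential-0 : ∀ k m → allShortPotential k (suc m) 0 ≡ short k 0 ^ m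
allShortPotential-0 k zero    = refl
allShortPotential-0 k (suc m) = refl

⊔-≤ᵇ : ∀ l m k → (l ℕ.⊔ m ℕ.≤ᵇ k) ≡ (l ℕ.≤ᵇ k) ∧ (m ℕ.≤ᵇ k)
⊔-≤ᵇ l m k = does-⇔
  (mk⇔ (λ le → ℕ.m⊔n≤o⇒m≤o l m le , ℕ.m⊔n≤o⇒n≤o l m le) (λ (p , q) → ℕ.⊔-lub p q))
  (l ℕ.⊔ m ℕ.≤? k) ((l ℕ.≤? k) ×-dec (m ℕ.≤? k))

-- Where the cost falls due, the potential equals it and is spent entirely. Before that, a one
-- completes the digit z + 1, whose indicator splits off by `⊔-≤ᵇ`, and `short-suc` averages over
-- the two children.
allShort-descent : ∀ k m z l → 𝟙 (allShort k m z l) ℚ.+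
  ½ ℚ.* (𝟙 (l ℕ.≤ᵇ k) ℚ.* allShortPotential k m (suc z) ℚ.+
         (𝟙 (l ℕ.⊔ suc z ℕ.≤ᵇ k) ℚ.* allShortPotential k (ℕ.pred m) 0 ℚ.+ 0ℚ)) ≡
  𝟙 (l ℕ.≤ᵇ k) ℚ.* allShortPotential k m z
allShort-descent k 0 z l =
  solve 2 (λ χ χ′ → con 0ℚ :+ con ½ :* (χ :* con 0ℚ :+ (χ′ :* con 0ℚ :+ con 0ℚ)) := χ :* con 0ℚ) refl
    (𝟙 (l ℕ.≤ᵇ k)) (𝟙 (l ℕ.⊔ suc z ℕ.≤ᵇ k))
allShort-descent k 1 zero l =
  solve 2 (λ χ χ′ → χ :+ con ½ :* (χ :* con 0ℚ :+ (χ′ :* con 0ℚ :+ con 0ℚ)) := χ :* con 1ℚ) refl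
    (𝟙 (l ℕ.≤ᵇ k)) (𝟙 (l ℕ.⊔ 1 ℕ.≤ᵇ k))
allShort-descent k 1 (suc z) l =
  solve 2 (λ χ χ′ → con 0ℚ :+ con ½ :* (χ :* con 0ℚ :+ (χ′ :* con 0ℚ :+ con 0ℚ)) := χ :* con 0ℚ) refl
    (𝟙 (l ℕ.≤ᵇ k)) (𝟙 (l ℕ.⊔ suc (suc z) ℕ.≤ᵇ k))
allShort-descent k (suc (suc m)) z l = begin
  0ℚ ℚ.+ ½ ℚ.* (χ ℚ.* (p ℚ.* R) ℚ.+ (𝟙 (l ℕ.⊔ suc z ℕ.≤ᵇ k) ℚ.* allShortPotential k (suc m) 0 ℚ.+ 0ℚ))
    ≡⟨ cong₂ (λ u v → 0ℚ ℚ.+ ½ ℚ.* (χ ℚ.* (p ℚ.* R) ℚ.+ (u ℚ.* v ℚ.+ 0ℚ)))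
         (trans (cong 𝟙 (⊔-≤ᵇ l (suc z) k)) (𝟙-∧ (l ℕ.≤ᵇ k) (z ℕ.<ᵇ k)))
         (allShortPotential-0 k m) ⟩
  0ℚ ℚ.+ ½ ℚ.* (χ ℚ.* (p ℚ.* R) ℚ.+ (χ ℚ.* b ℚ.* R ℚ.+ 0ℚ))
    ≡⟨ solve 4 (λ χ p R b → con 0ℚ :+ con ½ :* (χ :* (p :* R) :+ (χ :* b :* R :+ con 0ℚ))
                         := χ :* (con ½ :* (p :+ b) :* R)) refl χ p R b ⟩
  χ ℚ.* (½ ℚ.* (p ℚ.+ b) ℚ.* R)
    ≡⟨ cong (λ q → χ ℚ.* (q ℚ.* R)) (short-suc k z) ⟩
  χ ℚ.* (short k z ℚ.* R) ∎
  where
  open ≡-Reasoning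
  χ = 𝟙 (l ℕ.≤ᵇ k)
  p = short k (suc z)
  b = 𝟙 (z ℕ.<ᵇ k)
  R = short k 0 ^ m

-- The exceptional intervals for the parameter s and their total length

module Exceptional (s : ℕ) where

  k N K : ℕ
  k = s ℕ.* s
  N = 2 ℕ.^ (k + s)
  K = k + s + s

  isTooLong isAllShort : Node → Bool
  isTooLong  v = tooLong K (N ℕ.∸ ones v) (zeros v)
  isAllShort v = allShort k (suc N ℕ.∸ ones v) (zeros v) (longest v)

  cylinder : ℕ → Node → OpenInterval
  cylinder ℓ v = record
    { lo = left v ; hi = left v ℚ.+ ½ ^ ℓ ; lo≤hi = p≤p+q (left v) (0≤½^ ℓ) }

  -- With 2^ℓ nodes on level ℓ, the neighbourhoods of that level have total length 2^-(ℓ+s+1), and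
  -- those of all levels together at most 2^-s.
  radius : ℕ → ℚ
  radius ℓ = ½ ^ ℓ ℚ.* ½ ^ suc (suc (ℓ + s))

  0<radius : ∀ ℓ → 0ℚ ℚ.< radius ℓ
  0<radius ℓ = *-pos (½^-pos ℓ) (½^-pos (suc (suc (ℓ + s))))

  -- These neighbourhoods make the position of x relative to every dyadic
  -- rational decidable.
  endpointNbhd : ℕ → Node → OpenInterval
  endpointNbhd ℓ v = record
    { lo    = left v ℚ.+ ½ ^ ℓ ℚ.- radius ℓ
    ; hi    = left v ℚ.+ ½ ^ ℓ ℚ.+ radius ℓ
    ; lo≤hi = ℚ.+-monoʳ-≤ (left v ℚ.+ ½ ^ ℓ)
                (ℚ.≤-trans (ℚ.neg-antimono-≤ (ℚ.<⇒≤ (0<radius ℓ))) (ℚ.<⇒≤ (0<radius ℓ)))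
    }

  when : Bool → OpenInterval → List OpenInterval
  when b I = if b then I ∷ [] else []

  bad : ℕ → Node → List OpenInterval
  bad ℓ v = endpointNbhd ℓ v ∷ when (isTooLong v) (cylinder ℓ v) ++ when (isAllShort v) (cylinder ℓ v)

  badAt : ℕ → List OpenInterval
  badAt ℓ = concatMap (bad ℓ) (nodes ℓ)

  ∈-badAt : ∀ ℓ {I v} → v ∈ˡ nodes ℓ → I ∈ˡ bad ℓ v → I ∈ˡ badAt ℓ
  ∈-badAt ℓ {I} v∈ I∈ = ∈-concatMap⁺ (bad ℓ)
    (Any.map (λ eq → subst (λ u → I ∈ˡ bad ℓ u) eq I∈) v∈)

  nbhd-∈ : ∀ ℓ {v} → v ∈ˡ nodes ℓ → endpointNbhd ℓ v ∈ˡ badAt ℓ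
  nbhd-∈ ℓ v∈ = ∈-badAt ℓ v∈ (here refl)

  tooLong-∈ : ∀ ℓ {v} → v ∈ˡ nodes ℓ → isTooLong v ≡ true → cylinder ℓ v ∈ˡ badAt ℓ
  tooLong-∈ ℓ {v} v∈ eq = ∈-badAt ℓ v∈ (there (∈-++⁺ˡ
    (subst (λ b → cylinder ℓ v ∈ˡ when b (cylinder ℓ v)) (sym eq) (here refl))))

  allShort-∈ : ∀ ℓ {v} → v ∈ˡ nodes ℓ → isAllShort v ≡ true → cylinder ℓ v ∈ˡ badAt ℓ
  allShort-∈ ℓ {v} v∈ eq = ∈-badAt ℓ v∈ (there (∈-++⁺ʳ (when (isTooLong v) (cylinder ℓ v))
    (subst (λ b → cylinder ℓ v ∈ˡ when b (cylinder ℓ v)) (sym eq) (here refl))))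

  -- The potential on level ℓ is the tail sum of the costs 2^-(j+s+1) over j ≥ ℓ.
  nbhdPotential : Potential (λ ℓ v → ½ ^ suc (ℓ + s))
  nbhdPotential = record
    { φ       = λ ℓ v → ½ ^ (ℓ + s)
    ; 0≤φ     = λ ℓ v → 0≤½^ (ℓ + s)
    ; descent = λ ℓ v → ℚ.≤-reflexive
        (solve 1 (λ h → con ½ :* h :+ con ½ :* (con ½ :* h :+ (con ½ :* h :+ con 0ℚ)) := h)
          refl (½ ^ (ℓ + s)))
    }

  longPotential : Potential (λ ℓ v → 𝟙 (isTooLong v))
  longPotential = record
    { φ       = λ ℓ v → tooLongPotential K (N ℕ.∸ ones v) (zeros v)
    ; 0≤φ     = λ ℓ v → 0≤tooLongPotential K (N ℕ.∸ ones v) (zeros v)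
    ; descent = λ ℓ v@(node i z l a) → ℚ.≤-reflexive
        (subst (λ m → 𝟙 (isTooLong v) ℚ.+ ½ ℚ.* (tooLongPotential K (N ℕ.∸ i) (suc z) ℚ.+
                        (tooLongPotential K m 0 ℚ.+ 0ℚ)) ≡ tooLongPotential K (N ℕ.∸ i) z)
          (ℕ.pred[m∸n]≡m∸[1+n] N i) (tooLong-descent K (N ℕ.∸ i) z))
    }

  shortPotential : Potential (λ ℓ v → 𝟙 (isAllShort v))
  shortPotential = record
    -- The indicator annihilates the potential as soon as a completed digit exceeds k.
    { φ       = λ ℓ v → 𝟙 (longest v ℕ.≤ᵇ k) ℚ.* allShortPotential k (suc N ℕ.∸ ones v) (zeros v)
    ; 0≤φ     = λ ℓ v → *-nonNeg (0≤𝟙 (longest v ℕ.≤ᵇ k))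
                          (0≤allShortPotential k (suc N ℕ.∸ ones v) (zeros v))
    ; descent = λ ℓ v@(node i z l a) → ℚ.≤-reflexive
        (subst (λ m → 𝟙 (isAllShort v) ℚ.+
                  ½ ℚ.* (𝟙 (l ℕ.≤ᵇ k) ℚ.* allShortPotential k (suc N ℕ.∸ i) (suc z) ℚ.+
                    (𝟙 (l ℕ.⊔ suc z ℕ.≤ᵇ k) ℚ.* allShortPotential k m 0 ℚ.+ 0ℚ)) ≡
                  𝟙 (l ℕ.≤ᵇ k) ℚ.* allShortPotential k (suc N ℕ.∸ i) z)
          (ℕ.pred[m∸n]≡m∸[1+n] (suc N) i) (allShort-descent k (suc N ℕ.∸ i) z l))
    }

  potential : Potential (λ ℓ v → ½ ^ suc (ℓ + s) ℚ.+ (𝟙 (isTooLong v) ℚ.+ 𝟙 (isAllShort v)))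
  potential = nbhdPotential ⊕ (longPotential ⊕ shortPotential)

  -- The expected number of overlong digits is N 2^-K, and K exceeds the exponent k + s of N by
  -- exactly s.
  longPotential-root : φ longPotential 0 root ≡ ½ ^ s
  longPotential-root = begin
    tooLongPotential K N 0         ≡⟨ tooLongPotential-0 K N ⟩
    N • reach K 0                  ≡⟨ cong (N •_) (trans (reach-0 K) (^-homo-* ½ (k + s) s)) ⟩
    N • (½ ^ (k + s) ℚ.* ½ ^ s)    ≡⟨ 2^n•½^n (k + s) (½ ^ s) ⟩
    ½ ^ s                          ∎
    where
    open ≡-Reasoning

  shortPotential-root : φ shortPotential 0 root ℚ.≤ ½ ^ s
  shortPotential-root = begin
    1ℚ ℚ.* allShortPotential k (suc N) 0   ≡⟨ ℚ.*-identityˡ _ ⟩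
    allShortPotential k (suc N) 0          ≡⟨ allShortPotential-0 k N ⟩
    short k 0 ^ N                          ≤⟨ 1-½^-power k s ⟩
    ½ ^ s                                  ∎
    where open ℚ.≤-Reasoning

  length-cylinder : ∀ ℓ v → length (cylinder ℓ v) ≡ ½ ^ ℓ
  length-cylinder ℓ v = solve 2 (λ a h → a :+ h :- a := h) refl (left v) (½ ^ ℓ)

  length-when : ∀ ℓ v b → total length (when b (cylinder ℓ v)) ≡ ½ ^ ℓ ℚ.* 𝟙 b
  length-when ℓ v true  = trans (ℚ.+-identityʳ _)
    (trans (length-cylinder ℓ v) (sym (ℚ.*-identityʳ (½ ^ ℓ))))
  length-when ℓ v false = sym (ℚ.*-zeroʳ (½ ^ ℓ))

  -- The common factor 2^-ℓ is the weight of level ℓ in `∑-cost≤potential`; twice the radius is 2^-ℓ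
  -- times the cost in `nbhdPotential`.
  length-bad : ∀ ℓ v → total length (bad ℓ v) ≡
               ½ ^ ℓ ℚ.* (½ ^ suc (ℓ + s) ℚ.+ (𝟙 (isTooLong v) ℚ.+ 𝟙 (isAllShort v)))
  length-bad ℓ v = begin
    length (endpointNbhd ℓ v) ℚ.+ total length (U ++ V)
      ≡⟨ cong₂ ℚ._+_ (solve 2 (λ e r → e :+ r :- (e :- r) := r :+ r) refl (left v ℚ.+ ½ ^ ℓ) (radius ℓ))
           (trans (total-++ length U V)
             (cong₂ ℚ._+_ (length-when ℓ v (isTooLong v)) (length-when ℓ v (isAllShort v)))) ⟩
    radius ℓ ℚ.+ radius ℓ ℚ.+ (½ ^ ℓ ℚ.* u ℚ.+ ½ ^ ℓ ℚ.* w)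
      ≡⟨ solve 4 (λ h g u w → h :* (con ½ :* g) :+ h :* (con ½ :* g) :+ (h :* u :+ h :* w)
                           := h :* (g :+ (u :+ w))) refl (½ ^ ℓ) (½ ^ suc (ℓ + s)) u w ⟩
    ½ ^ ℓ ℚ.* (½ ^ suc (ℓ + s) ℚ.+ (u ℚ.+ w)) ∎
    where
    open ≡-Reasoning
    U = when (isTooLong v) (cylinder ℓ v)
    V = when (isAllShort v) (cylinder ℓ v)
    u = 𝟙 (isTooLong v)
    w = 𝟙 (isAllShort v)

  ∑-length-badAt : ∀ n → ∑ n (total length ∘ badAt) ℚ.≤ ½ ^ s ℚ.+ (½ ^ s ℚ.+ ½ ^ s)
  ∑-length-badAt n = begin
    ∑ n (total length ∘ badAt)
      ≤⟨ ∑-mono-≤ n (λ ℓ → ℚ.≤-reflexive (trans (total-concatMap length (bad ℓ) (nodes ℓ))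
           (trans (total-cong (length-bad ℓ) (nodes ℓ)) (total-* (½ ^ ℓ) _ (nodes ℓ))))) ⟩
    ∑ n (λ ℓ → ½ ^ ℓ ℚ.* total _ (nodes ℓ))
      ≤⟨ ∑-cost≤potential potential n ⟩
    φ potential 0 root
      ≤⟨ ℚ.+-monoʳ-≤ (½ ^ s) (ℚ.+-mono-≤ (ℚ.≤-reflexive longPotential-root) shortPotential-root) ⟩
    ½ ^ s ℚ.+ (½ ^ s ℚ.+ ½ ^ s) ∎
    where open ℚ.≤-Reasoning

-- Computing the digits of a real number

∣p-q∣≤r : ∀ {p q r} → p ℚ.≤ q ℚ.+ r → q ℚ.≤ p ℚ.+ r → ℚ.∣ p ℚ.- q ∣ ℚ.≤ r
∣p-q∣≤r {p} {q} {r} p≤q+r q≤p+r with ℚ.∣p∣≡p∨∣p∣≡-p (p ℚ.- q)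
... | inj₁ eq = subst (ℚ._≤ r) (sym eq) (subst (p ℚ.- q ℚ.≤_)
  (solve 2 (λ q r → q :+ r :- q := r) refl q r) (ℚ.+-monoˡ-≤ (ℚ.- q) p≤q+r))
... | inj₂ eq = subst (ℚ._≤ r) (sym (trans eq (solve 2 (λ p q → :- (p :- q) := q :- p) refl p q)))
  (subst (q ℚ.- p ℚ.≤_) (solve 2 (λ p r → p :+ r :- p := r) refl p r) (ℚ.+-monoˡ-≤ (ℚ.- p) q≤p+r))

∣p-q∣<r⇒p≤q+r : ∀ {p q r} → ℚ.∣ p ℚ.- q ∣ ℚ.< r → p ℚ.≤ q ℚ.+ r
∣p-q∣<r⇒p≤q+r {p} {q} {r} lt = begin
  p                       ≡⟨ solve 2 (λ p q → p := q :+ (p :- q)) refl p q ⟩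
  q ℚ.+ (p ℚ.- q)         ≤⟨ ℚ.+-monoʳ-≤ q (p≤∣p∣ (p ℚ.- q)) ⟩
  q ℚ.+ ℚ.∣ p ℚ.- q ∣     ≤⟨ ℚ.+-monoʳ-≤ q (ℚ.<⇒≤ lt) ⟩
  q ℚ.+ r                 ∎
  where
  open ℚ.≤-Reasoning
  p≤∣p∣ : ∀ p → p ℚ.≤ ℚ.∣ p ∣
  p≤∣p∣ p with ℚ.≤-total 0ℚ p
  ... | inj₁ 0≤p = ℚ.≤-reflexive (sym (ℚ.0≤p⇒∣p∣≡p 0≤p))
  ... | inj₂ p≤0 = ℚ.≤-trans p≤0 (ℚ.0≤∣p∣ p)

<-weakenʳ : ∀ {x p q} → x < fromℚ p → p ℚ.≤ q → x < fromℚ q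
<-weakenʳ (δ , 0<δ , N , h) p≤q = δ , 0<δ , N , λ n N≤n → ℚ.≤-trans (h n N≤n) p≤q

<-bounds : ∀ {x p q} → fromℚ p < x → x < fromℚ q → p ℚ.< q
<-bounds {x} {p} {q} (δ , 0<δ , M , h) (η , 0<η , N , g) = begin-strict
  p                 <⟨ p<p+ p 0<δ ⟩
  p ℚ.+ δ           ≤⟨ h (M ℕ.⊔ N) (ℕ.m≤m⊔n M N) ⟩
  approx x (M ℕ.⊔ N) <⟨ p<p+ _ 0<η ⟩
  approx x (M ℕ.⊔ N) ℚ.+ η ≤⟨ g (M ℕ.⊔ N) (ℕ.m≤n⊔m M N) ⟩
  q ∎
  where
  open ℚ.≤-Reasoning
  p<p+ : ∀ p {δ} → 0ℚ ℚ.< δ → p ℚ.< p ℚ.+ δ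
  p<p+ p {δ} 0<δ = subst (ℚ._< p ℚ.+ δ) (ℚ.+-identityʳ p) (ℚ.+-monoʳ-< p 0<δ)

-- Half of the gap makes room for the power of ½; the other half remains as witness of the strict
-- inequality.
<⇒½^ : ∀ {x p} → fromℚ p < x → ∃[ n ] fromℚ (p ℚ.+ ½ ^ n) < x
<⇒½^ {x} {p} (δ , 0<δ , N , h) = let n , ½^n≤ = ½^-archimedean (½ ℚ.* δ) (half-pos 0<δ) in
  n , ½ ℚ.* δ , half-pos 0<δ , N , λ j N≤j → begin
    p ℚ.+ ½ ^ n ℚ.+ ½ ℚ.* δ        ≤⟨ ℚ.+-monoˡ-≤ (½ ℚ.* δ) (ℚ.+-monoʳ-≤ p ½^n≤) ⟩
    p ℚ.+ ½ ℚ.* δ ℚ.+ ½ ℚ.* δ      ≡⟨ solve 2 (λ p δ → p :+ con ½ :* δ :+ con ½ :* δ := p :+ δ) refl p δ ⟩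
    p ℚ.+ δ                        ≤⟨ h j N≤j ⟩
    approx x j                     ∎
  where open ℚ.≤-Reasoning

-- A constructive substitute for trichotomy: an approximation accurate to δ, a quarter of the gap,
-- is compared with the midpoint, and either outcome leaves a margin of δ.
located : ∀ x {p q} → p ℚ.< q → fromℚ p < x ⊎ x < fromℚ q
located x {p} {q} p<q = compare (cauchy x δ 0<δ)
  where
  δ = ½ ℚ.* (½ ℚ.* (q ℚ.- p))
  0<δ : 0ℚ ℚ.< δ
  0<δ = half-pos (half-pos
    (subst (ℚ._< q ℚ.- p) (ℚ.+-inverseʳ p) (ℚ.+-monoˡ-< (ℚ.- p) p<q)))
  compare : ∃[ N ] (∀ i j → N ℕ.≤ i → N ℕ.≤ j → ℚ.∣ approx x i ℚ.- approx x j ∣ ℚ.< δ) →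
            fromℚ p < x ⊎ x < fromℚ q
  compare (N , close) with ℚ.≤-total (½ ℚ.* (p ℚ.+ q)) (approx x N)
  ... | inj₁ mid≤xN = inj₁ (δ , 0<δ , N , λ n N≤n → subst₂ ℚ._≤_
    (solve 2 (λ p q → con ½ :* (p :+ q) :- con ½ :* (con ½ :* (q :- p))
                   := p :+ con ½ :* (con ½ :* (q :- p))) refl p q)
    (solve 2 (λ y δ → y :+ δ :- δ := y) refl (approx x n) δ)
    (ℚ.+-monoˡ-≤ (ℚ.- δ) (ℚ.≤-trans mid≤xN
      (∣p-q∣<r⇒p≤q+r {approx x N} {approx x n} (close N n ℕ.≤-refl N≤n)))))
  ... | inj₂ xN≤mid = inj₂ (δ , 0<δ , N , λ n N≤n → subst (approx x n ℚ.+ δ ℚ.≤_)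
    (solve 2 (λ p q → con ½ :* (p :+ q) :+ con ½ :* (con ½ :* (q :- p)) :+ con ½ :* (con ½ :* (q :- p)) := q)
      refl p q)
    (ℚ.+-monoˡ-≤ δ (ℚ.≤-trans (∣p-q∣<r⇒p≤q+r {approx x n} {approx x N} (close n N N≤n ℕ.≤-refl))
      (ℚ.+-monoˡ-≤ δ xN≤mid))))

L-mono : ∀ d {m n} → m ℕ.≤ n → L d m ℕ.≤ L d n
L-mono d {n = zero}  ℕ.z≤n = ℕ.≤-refl
L-mono d {m} {suc n} m≤1+n with ℕ.m≤n⇒m<n∨m≡n m≤1+n
... | inj₁ (ℕ.s≤s m≤n) = ℕ.≤-trans (L-mono d m≤n) (ℕ.m≤m⊔n (L d n) (d n))
... | inj₂ refl        = ℕ.≤-refl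

L-lub : ∀ d n {K} → (∀ i → i ℕ.< n → d i ℕ.≤ K) → L d n ℕ.≤ K
L-lub d zero    h = ℕ.z≤n
L-lub d (suc n) h = ℕ.⊔-lub (L-lub d n (λ i i<n → h i (ℕ.m<n⇒m<1+n i<n))) (h n ℕ.≤-refl)

n≤digitSum : ∀ d → (∀ i → 1 ℕ.≤ d i) → ∀ n → n ℕ.≤ digitSum d n
n≤digitSum d 1≤d zero    = ℕ.z≤n
n≤digitSum d 1≤d (suc n) = subst (ℕ._≤ digitSum d (suc n)) (ℕ.+-comm n 1)
  (ℕ.+-mono-≤ (n≤digitSum d 1≤d n) (1≤d n))

tooLong-true : ∀ K {N i} → i ℕ.< N → tooLong K (N ℕ.∸ i) K ≡ true
tooLong-true K {N} {i} i<N with N ℕ.∸ i | ℕ.m<n⇒0<n∸m i<N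
... | suc m | _ = dec-true (K ℕ.≟ K) refl

allShort-true : ∀ k N {l} → l ℕ.≤ k → allShort k (suc N ℕ.∸ N) 0 l ≡ true
allShort-true k N {l} l≤k = trans
  (cong (λ m → allShort k m 0 l) (ℕ.m+n∸n≡m 1 N)) (dec-true (l ℕ.≤? k) l≤k)

module Digits
  (c : ℕ) (x : ℝ) (0<x : 0ℝ < x) (x≤1 : x ≤ 1ℝ)
  (avoids : ∀ s → c ℕ.≤ s → ∀ ℓ {I} → I ∈ˡ Exceptional.badAt s ℓ → ¬ (x ∈ I))
  where

  open Node

  -- Locating x just left and just right of the endpoint leaves open only the case that x is within
  -- the radius of it, and there x would lie in a removed neighbourhood.
  decide : ∀ ℓ {v} → v ∈ˡ nodes ℓ →
           fromℚ (left v ℚ.+ ½ ^ ℓ) < x ⊎ x < fromℚ (left v ℚ.+ ½ ^ ℓ)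
  decide ℓ {v} v∈ = compare (located x e-r<e) (located x e<e+r)
    where
    e = left v ℚ.+ ½ ^ ℓ
    r = Exceptional.radius c ℓ
    e-r<e : e ℚ.- r ℚ.< e
    e-r<e = subst (e ℚ.- r ℚ.<_) (ℚ.+-identityʳ e)
      (ℚ.+-monoʳ-< e (ℚ.neg-antimono-< (Exceptional.0<radius c ℓ)))
    e<e+r : e ℚ.< e ℚ.+ r
    e<e+r = subst (ℚ._< e ℚ.+ r) (ℚ.+-identityʳ e) (ℚ.+-monoʳ-< e (Exceptional.0<radius c ℓ))
    compare : fromℚ (e ℚ.- r) < x ⊎ x < fromℚ e → fromℚ e < x ⊎ x < fromℚ (e ℚ.+ r) →
              fromℚ e < x ⊎ x < fromℚ e
    compare (inj₂ x<e)   _            = inj₂ x<e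
    compare (inj₁ _)     (inj₁ e<x)   = inj₁ e<x
    compare (inj₁ e-r<x) (inj₂ x<e+r) = contradiction {A = x ∈ Exceptional.endpointNbhd c ℓ v}
      (e-r<x , x<e+r) (avoids c ℕ.≤-refl ℓ (Exceptional.nbhd-∈ c ℓ v∈))

  -- The state after n digits: a node ending in its n-th one (the root if n = 0), with x strictly
  -- inside its interval.
  record Stage (n : ℕ) : Set where
    field
      depth best : ℕ
      origin      : ℚ
      member     : node n 0 best origin ∈ˡ nodes depth
      origin<x    : fromℚ origin < x
      x<end      : x < fromℚ (origin ℚ.+ ½ ^ depth)

    zeros-∈ : ∀ z → node n z best origin ∈ˡ nodes (z + depth)
    zeros-∈ zero    = member
    zeros-∈ (suc z) = child-∈ {z + depth} (zeros-∈ z) (here refl)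

    one-∈ : ∀ z → node (suc n) 0 (best ℕ.⊔ suc z) (origin ℚ.+ ½ ^ (suc z + depth)) ∈ˡ nodes (suc z + depth)
    one-∈ z = child-∈ {z + depth} (zeros-∈ z) (there (here refl))

    Gap : ℕ → Set
    Gap z = x < fromℚ (origin ℚ.+ ½ ^ (z + depth)) × fromℚ (origin ℚ.+ ½ ^ (suc z + depth)) < x

    -- Since x exceeds the origin by more than 2^-F, the run of zeros is finite; `fuel` bounds the
    -- number of halvings still possible.
    search : ∀ F → fromℚ (origin ℚ.+ ½ ^ F) < x → ∀ fuel z → F ℕ.≤ fuel + z →
             x < fromℚ (origin ℚ.+ ½ ^ (z + depth)) → ∃[ z ] Gap z
    search F <x zero z F≤z x< = contradiction
      (ℚ.<-≤-trans (<-bounds {x} {origin ℚ.+ ½ ^ F} {origin ℚ.+ ½ ^ (z + depth)} <x x<)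
        (ℚ.+-monoʳ-≤ origin (½^-antimono (ℕ.m≤n⇒m≤n+o depth F≤z))))
      (ℚ.<-irrefl refl)
    search F <x (suc fuel) z F≤ x< =
      [ (λ <x → z , x< , <x)
      , search F <x fuel (suc z) (subst (F ℕ.≤_) (sym (ℕ.+-suc fuel z)) F≤)
      ]′ (decide (suc z + depth) {node n (suc z) best origin} (zeros-∈ (suc z)))

    abstract
      gap : ∃[ z ] Gap z
      gap = let F , <x = <⇒½^ {x} {origin} origin<x in
        search F <x F 0 (ℕ.≤-reflexive (sym (ℕ.+-identityʳ F))) x<end

  open Stage

  next : ∀ {n} → Stage n → Stage (suc n)
  next st = let z , x< , <x = gap st in record
    { depth   = suc z + depth st
    ; best    = best st ℕ.⊔ suc z
    ; origin   = origin st ℚ.+ ½ ^ (suc z + depth st)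
    ; member  = one-∈ st z
    ; origin<x = <x
    ; x<end   = subst (λ q → x < fromℚ q)
        (trans (cong (origin st ℚ.+_) (sym (½^-halves (z + depth st)))) (sym (ℚ.+-assoc (origin st) _ _))) x<
    }

  stage : ∀ n → Stage n
  stage zero = record
    { depth = 0 ; best = 0 ; origin = 0ℚ ; member = here refl ; origin<x = 0<x ; x<end = x<1 }
    where
    x<1 : x < fromℚ (0ℚ ℚ.+ ½ ^ 0)
    -- The right endpoint of the root is 1, so `decide` also rules out x = 1.
    x<1 = [ (λ 1<x → contradiction 1<x x≤1) , id ]′ (decide 0 {root} (here refl))
  stage (suc n) = next (stage n)

  d : ℕ → ℕ
  d n = suc (proj₁ (gap (stage n)))

  best≡L : ∀ n → best (stage n) ≡ L d n
  best≡L zero    = refl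
  best≡L (suc n) = cong (ℕ._⊔ d n) (best≡L n)

  depth≡digitSum : ∀ n → depth (stage n) ≡ digitSum d n
  depth≡digitSum zero    = refl
  depth≡digitSum (suc n) = trans (cong (λ m → d n + m) (depth≡digitSum n)) (ℕ.+-comm (d n) _)

  origin≡∑ : ∀ n → origin (stage n) ≡ ∑ n (λ i → 2^- digitSum d (suc i))
  origin≡∑ zero    = refl
  origin≡∑ (suc n) = cong₂ ℚ._+_ (origin≡∑ n)
    (trans (cong (½ ^_) (depth≡digitSum (suc n))) (sym (2^-≡½^ (digitSum d (suc n)))))

  isExpansion : IsExpansion d x
  isExpansion = record { digit≥1 = 1≤d ; sum≡x = converges }
    where
    open ℚ.≤-Reasoning
    1≤d : ∀ i → 1 ℕ.≤ d i
    1≤d i = ℕ.s≤s ℕ.z≤n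
    -- The error is at most 2^-depth, and the depth, a sum of n digits, is at least n. The other
    -- half of ε witnesses strictness.
    close : ∀ n {ε} → ½ ^ n ℚ.≤ ½ ℚ.* ε → 0ℚ ℚ.< ε → ∣ fromℚ (origin (stage n)) - x ∣ < fromℚ ε
    close n {ε} small 0<ε with origin<x (stage n) | x<end (stage n)
    ... | δ , 0<δ , M , h | η , 0<η , N , g =
      ½ ℚ.* ε , half-pos 0<ε , M ℕ.⊔ N , λ j M⊔N≤j → begin
        ℚ.∣ origin (stage n) ℚ.- approx x j ∣ ℚ.+ ½ ℚ.* ε
          ≤⟨ ℚ.+-monoˡ-≤ (½ ℚ.* ε) (∣p-q∣≤r
               (begin
                 origin (stage n)                      ≤⟨ p≤p+q _ (ℚ.<⇒≤ 0<δ) ⟩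
                 origin (stage n) ℚ.+ δ                ≤⟨ h j (ℕ.m⊔n≤o⇒m≤o M N M⊔N≤j) ⟩
                 approx x j                           ≤⟨ p≤p+q _ (ℚ.<⇒≤ (half-pos 0<ε)) ⟩
                 approx x j ℚ.+ ½ ℚ.* ε               ∎)
               (begin
                 approx x j                           ≤⟨ p≤p+q _ (ℚ.<⇒≤ 0<η) ⟩
                 approx x j ℚ.+ η                     ≤⟨ g j (ℕ.m⊔n≤o⇒n≤o M N M⊔N≤j) ⟩
                 origin (stage n) ℚ.+ ½ ^ depth (stage n)
                   ≤⟨ ℚ.+-monoʳ-≤ (origin (stage n)) (ℚ.≤-trans (½^-antimono
                        (subst (n ℕ.≤_) (sym (depth≡digitSum n)) (n≤digitSum d 1≤d n))) small) ⟩
                 origin (stage n) ℚ.+ ½ ℚ.* ε          ∎)) ⟩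
        ½ ℚ.* ε ℚ.+ ½ ℚ.* ε
          ≡⟨ half+half ε ⟩
        ε ∎
    converges : (λ n → fromℚ (∑ n (λ i → 2^- digitSum d (suc i)))) ⟶ x
    converges ε 0<ε = let M , ½^M≤ = ½^-archimedean (½ ℚ.* ε) (half-pos 0<ε) in
      M , λ n M≤n → subst (λ q → ∣ fromℚ q - x ∣ < fromℚ ε) (origin≡∑ n)
        (close n (ℚ.≤-trans (½^-antimono M≤n) ½^M≤) 0<ε)

  module _ (s : ℕ) (c≤s : c ℕ.≤ s) where
    open Exceptional s using (k; N; K; tooLong-∈; allShort-∈)

    -- A digit above K would begin with K zeros after stage i, and the cylinder reached by them
    -- contains x although it was removed, as i < N.
    d≤K : ∀ i → i ℕ.< N → d i ℕ.≤ K
    d≤K i i<N = ℕ.≮⇒≥ λ K<d → avoids s c≤s (K + depth (stage i))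
      (tooLong-∈ (K + depth (stage i)) (zeros-∈ (stage i) K) (tooLong-true K i<N))
      ( origin<x (stage i)
      , <-weakenʳ {x} {origin (stage i) ℚ.+ ½ ^ (proj₁ (gap (stage i)) + depth (stage i))}
          (proj₁ (proj₂ (gap (stage i))))
          (ℚ.+-monoʳ-≤ (origin (stage i)) (½^-antimono (ℕ.+-monoˡ-≤ (depth (stage i)) (ℕ.s≤s⁻¹ K<d)))))

    L≤K : L d N ℕ.≤ K
    L≤K = L-lub d N d≤K

    -- If the first N digits were all at most k, the cylinder ending in the N-th one would have been
    -- removed, yet it contains x.
    k<L : k ℕ.< L d N
    k<L = ℕ.≰⇒> λ L≤k → avoids s c≤s (depth (stage N))
      (allShort-∈ (depth (stage N)) (member (stage N))
        (allShort-true k N (subst (ℕ._≤ k) (sym (best≡L N)) L≤k)))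
      (origin<x (stage N) , x<end (stage N))

-- From digit bounds to the limit

ι : ℕ → ℚ
ι n = + n ℚ./ 1

ι-mono-≤ : ∀ {m n} → m ℕ.≤ n → ι m ℚ.≤ ι n
ι-mono-≤ {m} {n} m≤n = frac-≤ m n 1 1 (ℕ.*-monoˡ-≤ 1 m≤n)

ι-+ : ∀ m n → ι (m + n) ≡ ι m ℚ.+ ι n
ι-+ zero    n = sym (ℚ.+-identityˡ (ι n))
ι-+ (suc m) n = begin
  ι (suc (m + n))            ≡⟨ frac-suc (m + n) 1 ⟩
  ι (m + n) ℚ.+ 1ℚ           ≡⟨ cong (ℚ._+ 1ℚ) (ι-+ m n) ⟩
  ι m ℚ.+ ι n ℚ.+ 1ℚ         ≡⟨ solve 2 (λ a b → a :+ b :+ con 1ℚ := a :+ con 1ℚ :+ b) refl (ι m) (ι n) ⟩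
  ι m ℚ.+ 1ℚ ℚ.+ ι n         ≡⟨ cong (ℚ._+ ι n) (frac-suc m 1) ⟨
  ι (suc m) ℚ.+ ι n          ∎
  where open ≡-Reasoning

ι-* : ∀ m n → ι (m ℕ.* n) ≡ m • ι n
ι-* zero    n = refl
ι-* (suc m) n = trans (ι-+ n (m ℕ.* n)) (cong (ι n ℚ.+_) (ι-* m n))

2^t*m≤n⇒ιm≤½^t*ιn : ∀ t {m n} → 2 ℕ.^ t ℕ.* m ℕ.≤ n → ι m ℚ.≤ ½ ^ t ℚ.* ι n
2^t*m≤n⇒ιm≤½^t*ιn t {m} {n} le = begin
  ι m                                   ≡⟨ 2^n•½^n t (ι m) ⟨
  (2 ℕ.^ t) • (½ ^ t ℚ.* ι m)           ≡⟨ ×-comm-* (2 ℕ.^ t) (½ ^ t) (ι m) ⟨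
  ½ ^ t ℚ.* (2 ℕ.^ t) • ι m             ≡⟨ cong (½ ^ t ℚ.*_) (ι-* (2 ℕ.^ t) m) ⟨
  ½ ^ t ℚ.* ι (2 ℕ.^ t ℕ.* m)           ≤⟨ *-monoˡ-≤ (0≤½^ t) (ι-mono-≤ le) ⟩
  ½ ^ t ℚ.* ι n                         ∎
  where open ℚ.≤-Reasoning

-- The floor is exact at powers of 2^e, so the bound holds for every approximation and not only in
-- the limit.
log₂-approx-≥ : ∀ n e j → 2 ℕ.^ e ℕ.≤ n → ι e ℚ.≤ log₂-approx n j
log₂-approx-≥ n e j 2^e≤n = frac-≤ e l 1 (suc j) (begin
  e ℕ.* suc j                          ≡⟨ ⌊log₂[2^n]⌋≡n (e ℕ.* suc j) ⟨
  ⌊log₂ (2 ℕ.^ (e ℕ.* suc j)) ⌋        ≡⟨ cong ⌊log₂_⌋ (ℕ.^-*-assoc 2 e (suc j)) ⟨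
  ⌊log₂ ((2 ℕ.^ e) ℕ.^ suc j) ⌋        ≤⟨ ⌊log₂⌋-mono-≤ (ℕ.^-monoˡ-≤ (suc j) 2^e≤n) ⟩
  l                                    ≡⟨ ℕ.*-identityʳ l ⟨
  l ℕ.* 1                              ∎)
  where
  open ℕ.≤-Reasoning
  l = ⌊log₂ (n ℕ.^ suc j) ⌋

log₂-approx-≤ : ∀ n e j → n ℕ.≤ 2 ℕ.^ e → log₂-approx n j ℚ.≤ ι e
log₂-approx-≤ n e j n≤2^e = frac-≤ l e (suc j) 1 (begin
  l ℕ.* 1                              ≡⟨ ℕ.*-identityʳ l ⟩
  l                                    ≤⟨ ⌊log₂⌋-mono-≤ (ℕ.^-monoˡ-≤ (suc j) n≤2^e) ⟩
  ⌊log₂ ((2 ℕ.^ e) ℕ.^ suc j) ⌋        ≡⟨ cong ⌊log₂_⌋ (ℕ.^-*-assoc 2 e (suc j)) ⟩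
  ⌊log₂ (2 ℕ.^ (e ℕ.* suc j)) ⌋        ≡⟨ ⌊log₂[2^n]⌋≡n (e ℕ.* suc j) ⟩
  e ℕ.* suc j                          ∎)
  where
  open ℕ.≤-Reasoning
  l = ⌊log₂ (n ℕ.^ suc j) ⌋

∣p/q-1∣≤ε : ∀ p {q ε} → 0ℚ ℚ.< q → ℚ.∣ p ℚ.- q ∣ ℚ.≤ ε ℚ.* q → ℚ.∣ p ℚ.* inv q ℚ.- 1ℚ ∣ ℚ.≤ ε
∣p/q-1∣≤ε p {q} {ε} 0<q le = begin
  ℚ.∣ p ℚ.* inv q ℚ.- 1ℚ ∣              ≡⟨ cong (λ r → ℚ.∣ p ℚ.* inv q ℚ.- r ∣) (*-inv q 0<q) ⟨
  ℚ.∣ p ℚ.* inv q ℚ.- q ℚ.* inv q ∣     ≡⟨ cong ℚ.∣_∣ (solve 3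
    (λ p q i → p :* i :- q :* i := (p :- q) :* i) refl p q (inv q)) ⟩
  ℚ.∣ (p ℚ.- q) ℚ.* inv q ∣             ≡⟨ ℚ.∣p*q∣≡∣p∣*∣q∣ (p ℚ.- q) (inv q) ⟩
  ℚ.∣ p ℚ.- q ∣ ℚ.* ℚ.∣ inv q ∣         ≡⟨ cong (ℚ.∣ p ℚ.- q ∣ ℚ.*_) (ℚ.0≤p⇒∣p∣≡p (ℚ.<⇒≤ (inv-pos 0<q))) ⟩
  ℚ.∣ p ℚ.- q ∣ ℚ.* inv q               ≤⟨ ℚ.*-monoʳ-≤-nonNeg (inv q) {{ℚ.nonNegative (ℚ.<⇒≤ (inv-pos 0<q))}} le ⟩
  ε ℚ.* q ℚ.* inv q                     ≡⟨ ℚ.*-assoc ε q (inv q) ⟩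
  ε ℚ.* (q ℚ.* inv q)                   ≡⟨ cong (ε ℚ.*_) (*-inv q 0<q) ⟩
  ε ℚ.* 1ℚ                              ≡⟨ ℚ.*-identityʳ ε ⟩
  ε                                     ∎
  where open ℚ.≤-Reasoning

-- The search goes upwards from `s₀` and keeps f s ≤ n; since s < f s, it must stop before s reaches
-- n.
window : (f : ℕ → ℕ) → (∀ s → s ℕ.< f s) → ∀ {s₀ n} → f s₀ ℕ.≤ n →
         ∃[ s ] (s₀ ℕ.≤ s × f s ℕ.≤ n × n ℕ.≤ f (suc s))
window f s<fs {s₀} {n} = go n s₀ (ℕ.m≤m+n n s₀)
  where
  go : ∀ fuel s → n ℕ.≤ fuel + s → f s ℕ.≤ n → ∃[ t ] (s ℕ.≤ t × f t ℕ.≤ n × n ℕ.≤ f (suc t))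
  go zero       s n≤s fs≤n = contradiction (ℕ.≤-trans (s<fs s) (ℕ.≤-trans fs≤n n≤s)) (ℕ.<-irrefl refl)
  go (suc fuel) s n≤  fs≤n with ℕ.≤-total n (f (suc s))
  ... | inj₁ n≤f = s , ℕ.≤-refl , fs≤n , n≤f
  ... | inj₂ f≤n with t , s<t , rest ← go fuel (suc s) (subst (n ℕ.≤_) (sym (ℕ.+-suc fuel s)) n≤) f≤n =
    t , ℕ.<⇒≤ s<t , rest

module Limit
  (d : ℕ → ℕ) (c : ℕ)
  (lower : ∀ s → c ℕ.≤ s → Exceptional.k s ℕ.< L d (Exceptional.N s))
  (upper : ∀ s → c ℕ.≤ s → L d (Exceptional.N s) ℕ.≤ Exceptional.K s)
  where

  e : ℕ → ℕ
  e s = s ℕ.* s + s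

  -- With this error bound, K(s+1) = e(s) + D(s) and e(s+1) + 1 = s² + D(s), the identities behind
  -- the upper and the lower estimate of L.
  D : ℕ → ℕ
  D s = 3 ℕ.* suc s

  -- By monotonicity, L at n lies between its values at N(s) and N(s+1), while log₂ n lies between
  -- e(s) and e(s+1).
  ∣L-log₂∣≤D : ∀ s n j → c ℕ.≤ s → 2 ℕ.^ e s ℕ.≤ n → n ℕ.≤ 2 ℕ.^ e (suc s) →
               ℚ.∣ ι (L d n) ℚ.- log₂-approx n j ∣ ℚ.≤ ι (D s)
  ∣L-log₂∣≤D s n j c≤s lo≤n n≤hi = ∣p-q∣≤r
    (begin
      ι (L d n)                          ≤⟨ ι-mono-≤ L≤ ⟩
      ι (e s + D s)                      ≡⟨ ι-+ (e s) (D s) ⟩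
      ι (e s) ℚ.+ ι (D s)                ≤⟨ ℚ.+-monoˡ-≤ (ι (D s)) (log₂-approx-≥ n (e s) j lo≤n) ⟩
      log₂-approx n j ℚ.+ ι (D s)        ∎)
    (begin
      log₂-approx n j                    ≤⟨ log₂-approx-≤ n (e (suc s)) j n≤hi ⟩
      ι (e (suc s))                      ≤⟨ ι-mono-≤ ≤L ⟩
      ι (L d n + D s)                    ≡⟨ ι-+ (L d n) (D s) ⟩
      ι (L d n) ℚ.+ ι (D s)              ∎)
    where
    open ℚ.≤-Reasoning
    K≡ : ∀ s → suc s ℕ.* suc s + suc s + suc s ≡ (s ℕ.* s + s) + 3 ℕ.* suc s
    K≡ = solve-∀
    e≡ : ∀ s → suc (suc s ℕ.* suc s + suc s) ≡ s ℕ.* s + 3 ℕ.* suc s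
    e≡ = solve-∀
    L≤ : L d n ℕ.≤ e s + D s
    L≤ = ℕ.≤-trans (L-mono d n≤hi) (ℕ.≤-trans (upper (suc s) (ℕ.m≤n⇒m≤1+n c≤s))
      (ℕ.≤-reflexive (K≡ s)))
    ≤L : e (suc s) ℕ.≤ L d n + D s
    ≤L = ℕ.≤-trans (ℕ.n≤1+n (e (suc s))) (ℕ.≤-trans (ℕ.≤-reflexive (e≡ s))
      (ℕ.+-monoˡ-≤ (D s) (ℕ.<⇒≤ (ℕ.<-≤-trans (lower s c≤s) (L-mono d lo≤n)))))

  L/log₂⟶1 : (λ n → fromℕ (L d (2 + n)) ÷ log₂ (2 + n) ⟨ 0<log₂ n ⟩) ⟶ 1ℝ
  L/log₂⟶1 ε 0<ε =
    let t , ½^t≤ = ½^-archimedean (½ ℚ.* ε) (half-pos 0<ε)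
    -- From s ≥ 3·2^t on, 2^t·3(s+1) ≤ s(s+1) = e(s), so the error is at most 2^-t times log₂ n; `c`
    -- makes the digit bounds available.
    in 2 ℕ.^ e (c ℕ.⊔ 3 ℕ.* 2 ℕ.^ t) , λ n N≤n →
       ½ ℚ.* ε , half-pos 0<ε , 0 , λ j _ →
       let s , s₀≤s , lo≤n , n≤hi = window
             (λ s → 2 ℕ.^ e s) s<2^e {c ℕ.⊔ 3 ℕ.* 2 ℕ.^ t} {2 + n} (ℕ.≤-trans N≤n (ℕ.m≤n+m n 2))
       in begin
         ℚ.∣ ι (L d (2 + n)) ℚ.* inv (log₂-approx (2 + n) j) ℚ.- 1ℚ ∣ ℚ.+ ½ ℚ.* ε
           ≤⟨ ℚ.+-monoˡ-≤ (½ ℚ.* ε) (ℚ.≤-trans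
                (∣p/q-1∣≤ε (ι (L d (2 + n))) (ℚ.<-≤-trans (ℚ.positive⁻¹ 1ℚ)
                    (1≤log₂-approx (2 + n) j (ℕ.s≤s (ℕ.s≤s ℕ.z≤n))))
                  (small t s (2 + n) j s₀≤s lo≤n n≤hi))
                ½^t≤) ⟩
         ½ ℚ.* ε ℚ.+ ½ ℚ.* ε
           ≡⟨ half+half ε ⟩
         ε ∎
    where
    open ℚ.≤-Reasoning
    s<2^e : ∀ s → s ℕ.< 2 ℕ.^ e s
    s<2^e s = ℕ.≤-<-trans (ℕ.m≤n+m s (s ℕ.* s)) (n<2^n (e s))
    small : ∀ t s n j → c ℕ.⊔ 3 ℕ.* 2 ℕ.^ t ℕ.≤ s → 2 ℕ.^ e s ℕ.≤ n → n ℕ.≤ 2 ℕ.^ e (suc s) →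
            ℚ.∣ ι (L d n) ℚ.- log₂-approx n j ∣ ℚ.≤ ½ ^ t ℚ.* log₂-approx n j
    small t s n j s₀≤s lo≤n n≤hi = begin
      ℚ.∣ ι (L d n) ℚ.- log₂-approx n j ∣    ≤⟨ ∣L-log₂∣≤D s n j (ℕ.m⊔n≤o⇒m≤o c _ s₀≤s) lo≤n n≤hi ⟩
      ι (D s)                                ≤⟨ 2^t*m≤n⇒ιm≤½^t*ιn t 2^t*D≤e ⟩
      ½ ^ t ℚ.* ι (e s)                      ≤⟨ *-monoˡ-≤ (0≤½^ t) (log₂-approx-≥ n (e s) j lo≤n) ⟩
      ½ ^ t ℚ.* log₂-approx n j              ∎
      where
      2^t*D≤e : 2 ℕ.^ t ℕ.* D s ℕ.≤ e s
      2^t*D≤e = ℕ.≤-trans (ℕ.≤-reflexive (assoc (2 ℕ.^ t) (suc s)))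
        (ℕ.≤-trans (ℕ.*-monoˡ-≤ (suc s) (ℕ.m⊔n≤o⇒n≤o c _ s₀≤s))
          (ℕ.≤-reflexive (trans (ℕ.*-suc s s) (ℕ.+-comm s (s ℕ.* s)))))
        where
        assoc : ∀ a b → a ℕ.* (3 ℕ.* b) ≡ 3 ℕ.* a ℕ.* b
        assoc = solve-∀

-- Union of the exceptional intervals over all large parameters

theorem1p3 : AlmostEvery ⟨0,1] (λ x →
    ∃[ d ] (IsExpansion d x ×
    (λ n → fromℕ (L d (2 + n)) ÷ log₂ (2 + n) ⟨ 0<log₂ n ⟩) ⟶ 1ℝ))
theorem1p3 ε 0<ε = enumerate [] (diagonal badFrom) , small , λ x (0<x , x≤1) avoids →
  let open Digits c x 0<x x≤1 (outside {x} avoids) in d , isExpansion , Limit.L/log₂⟶1 d c k<L L≤K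
  where
  open ℚ.≤-Reasoning

  n₀ : ℕ
  n₀ = proj₁ (½^-archimedean ε 0<ε)

  -- The parameter s costs 3·2^-s; summing over s ≥ c gives 6·2^-c, which is at most 2^-n₀ because 6
  -- ≤ 2^3.
  c : ℕ
  c = 3 + n₀

  badFrom : ℕ → ℕ → List OpenInterval
  badFrom r = Exceptional.badAt (r + c)

  small : ∀ n → ∑ n (λ k → length (enumerate [] (diagonal badFrom) k)) ℚ.≤ ε
  small n = begin
    ∑ n (length ∘ enumerate [] (diagonal badFrom))
      ≤⟨ enumerate-length n [] (diagonal badFrom) ⟩
    0ℚ ℚ.+ ∑ n (total length ∘ diagonal badFrom)
      ≡⟨ ℚ.+-identityˡ _ ⟩
    ∑ n (total length ∘ diagonal badFrom)
      ≤⟨ ∑-diagonal length badFrom (λ r → h r ℚ.+ (h r ℚ.+ h r)) (λ r → Exceptional.∑-length-badAt (r + c)) n ⟩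
    ∑ n (λ r → h r ℚ.+ (h r ℚ.+ h r))
      ≡⟨ trans (∑-+ n h (λ r → h r ℚ.+ h r)) (cong (∑ n h ℚ.+_) (∑-+ n h h)) ⟩
    ∑ n h ℚ.+ (∑ n h ℚ.+ ∑ n h)
      ≤⟨ ℚ.+-mono-≤ (∑-geometric c n) (ℚ.+-mono-≤ (∑-geometric c n) (∑-geometric c n)) ⟩
    q ℚ.+ (q ℚ.+ q)
      ≤⟨ ≤-by-difference q (+-nonNeg (0≤½^ c) (0≤½^ c))
           (solve 1 (λ p → let h = con ½ :* (con ½ :* (con ½ :* p)) ; q = h :+ h in
             q :+ (q :+ q) :+ q := p) refl (½ ^ n₀)) ⟩
    ½ ^ n₀
      ≤⟨ proj₂ (½^-archimedean ε 0<ε) ⟩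
    ε ∎
    where
    h : ℕ → ℚ
    h r = ½ ^ (r + c)
    q = ½ ^ c ℚ.+ ½ ^ c

  outside : ∀ {x} → (∀ n → ¬ (x ∈ enumerate [] (diagonal badFrom) n)) →
            ∀ s → c ℕ.≤ s → ∀ ℓ {I} → I ∈ˡ Exceptional.badAt s ℓ → ¬ (x ∈ I)
  outside {x} avoids s c≤s ℓ {I} I∈ x∈I =
    -- An interval of level ℓ for the parameter s sits in row s - c, hence on the antidiagonal (s -
    -- c) + ℓ.
    let r     = s ℕ.∸ c
        I∈′   = subst (λ s → I ∈ˡ Exceptional.badAt s ℓ) (sym (ℕ.m∸n+n≡m c≤s)) I∈
        n , eq = enumerate-complete [] (diagonal badFrom) (r + ℓ) (∈-diagonal badFrom r ℓ I∈′)
    in avoids n (subst (x ∈_) (sym eq) x∈I)
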